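{- Let $k\ge 1$, $b>0$, $c>0$ be integers. If there exist nonnegative integers $l_1,\dots,l_k$ such that the infinite circulant graph $C_\infty(l_1,\dots,l_k)$ with $k$ distances has a perfect $2$-colouring with parameters $(b,c)$, then for each prime $q$ and each positive integer $t$ such that $q^t$ divides $\frac{b+c}{\gcd(b,c)}$, it holds that $$b+c\le 2k+\frac{b+c}{q^t}.$$
   Context: Graphs may have loops and multiple edges. The infinite circulant graph with $k$ distances $C_\infty(l_1,\dots,l_k)$ has vertex set $\mathbb{Z}$, and numbers differing by $l_i$, for some $i$, are joined by an edge; it is $2k$-regular, the neighbours of a vertex $g$, counted with multiplicity, being $g+l_i$ and $g-l_i$ for $i=1,\dots,k$. (The $l_i$ are not required to be distinct or nonzero.) A perfect $2$-colouring with parameters $(b,c)$ of a regular graph is a colouring of its vertices in two colours (black and white) such that each black vertex has exactly $b$ white neighbours and each white vertex has exactly $c$ black neighbours (neighbours counted with multiplicity). -}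

module Defs where

open import Data.Integer.Base as ℤ using (ℤ; +_)
open import Data.Nat.Base using (ℕ; _+_; NonZero; ≢-nonZero; ≢-nonZero⁻¹)
open import Data.Nat.GCD using (gcd; gcd[m,n]≢0)
open import Data.Product.Base using (_×_)
open import Data.Sum.Base using (inj₁)
open import Data.Vec.Base using (Vec; map; _++_; count)
open import Relation.Binary.Definitions using (DecidableEquality)
open import Relation.Binary.PropositionalEquality.Core using (_≡_; refl)
open import Relation.Nullary.Decidable.Core using (yes; no)

-- A d-regular graph, possibly with loops and multiple edges, is represented
-- by the vectors of neighbours of its vertices: a vertex occurs in such a
-- vector as often as its multiplicity as a neighbour.
Neighbourhoods : Set → ℕ → Set
Neighbourhoods V d = V → Vec V d

-- The graph C_∞(l₁,…,lₖ).  Each lᵢ contributes two neighbours of g even when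
-- they coincide: for lᵢ = 0, g occurs twice among its own neighbours.
circulant : ∀ {k} → Vec ℕ k → Neighbourhoods ℤ (k + k)
circulant ls g = map (λ l → g ℤ.+ + l) ls ++ map (λ l → g ℤ.- + l) ls

data Colour : Set where
  black white : Colour

_≟ᶜ_ : DecidableEquality Colour
black ≟ᶜ black = yes refl
black ≟ᶜ white = no λ ()
white ≟ᶜ black = no λ ()
white ≟ᶜ white = yes refl

module _ {V : Set} {d : ℕ} (N : Neighbourhoods V d) (f : V → Colour) where

  #neighbours : Colour → V → ℕ
  #neighbours x v = count (λ u → f u ≟ᶜ x) (N v)

  IsPerfect2Colouring : ℕ → ℕ → Set
  IsPerfect2Colouring b c =
    (∀ v → f v ≡ black → #neighbours white v ≡ b) ×
    (∀ v → f v ≡ white → #neighbours black v ≡ c)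

instance
  gcd-nonZero : ∀ {m n} .{{_ : NonZero m}} → NonZero (gcd m n)
  gcd-nonZero {m} {n} = ≢-nonZero (gcd[m,n]≢0 m n (inj₁ (≢-nonZero⁻¹ m)))

{-# OPTIONS --safe #-}

-- Writing the colouring as a 0/1 sequence F, perfection says that the sequence
-- (n − 2k) F(v) + Σ (F(v + l) + F(v − l)), n = b + c, is constantly c.  Two equal
-- windows allow F to be replaced by a solution with a period T = q^s T′, q ∤ T′,
-- and folding gives sequences P and F̄ on ℤ/q^s with constant correlation, where P
-- has sum n and is nonnegative away from 0, while P(0) ≥ n − 2k.  Counting gives
-- n ΣF̄ = c T, so a prime power q^r dividing ΣF̄ has r ≤ s − t.
--
-- It remains to show q^t P(0) ≤ ΣP, by induction on s.  As the q^s-th cyclotomic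
-- ideal of the group ring ℤ[ℤ/q^s] is prime, P or F̄ has the period q^(s−1).  Fold
-- the other one to that period.  If F̄ has the period, ΣF̄ loses a factor q and P(0)
-- can only grow; otherwise ΣP loses a factor q.  By the bound on r, the second case
-- occurs at least t times.

module Submission where

import Algebra.Properties.CommutativeSemigroup as CommutativeSemigroup
open import Data.Bool.Base using (true; false; if_then_else_)
open import Data.Fin.Base as Fin using (Fin; toℕ; fromℕ<; funToFin; finToFun)
import Data.Fin.Properties as Fin
open import Data.Integer.Base as ℤ using (ℤ; +_; 0ℤ; 1ℤ)
import Data.Integer.Divisibility.Signed as ℤ
import Data.Integer.Properties as ℤ
import Data.Integer.Tactic.RingSolver as ℤSolver
open import Data.Nat.Base using (ℕ; zero; suc; _+_; _*_; _∸_; _^_; _/_; _%_; _≤_; _<_; z≤n; z<s; s<s; _⊔_; NonZero; ≢-nonZero⁻¹; nonTrivial⇒n>1)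
open import Data.Nat.Combinatorics using (_C_; nCn≡1; nC1≡n; k>n⇒nCk≡0; nCk+nC[k+1]≡[n+1]C[k+1])
open import Data.Nat.DivMod using (m≡m%n+[m/n]*n; m%n<n; m<n⇒m%n≡m; [m+n]%n≡m%n; m≤n⇒[n∸m]%m≡n%m; m*n/n≡m; n/n≡1; +-distrib-/-∣ʳ; m/n*n≡m; m*[n/m]≡n)
open import Data.Nat.Divisibility using (_∣_; divides)
import Data.Nat.Divisibility as ℕ
open import Data.Nat.GCD using (gcd; gcd[m,n]∣m; gcd[m,n]∣n; gcd-greatest)
open import Data.Nat.Induction using (<-wellFounded)
open import Data.Nat.Primality using (Prime; prime⇒nonZero; prime⇒nonTrivial; euclidsLemma)
open import Data.Nat.Properties using (m^n≢0)
import Data.Nat.Properties as ℕ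
import Data.Nat.Tactic.RingSolver as ℕSolver
open import Data.Product.Base using (∃-syntax; _×_; _,_)
open import Data.Sum.Base using (_⊎_; inj₁; inj₂)
open import Data.Vec.Base using (Vec; []; _∷_; map; _++_; sum; count)
open import Function.Base using (_∘_)
open import Induction.WellFounded using (Acc; acc)
open import Relation.Binary.PropositionalEquality
open import Relation.Nullary using (yes; no; does; contradiction; ¬_)
open import Relation.Nullary.Decidable using (dec-true; dec-false)

private
  module ℕ+ = CommutativeSemigroup ℕ.+-commutativeSemigroup
  module ℤ+ = CommutativeSemigroup ℤ.+-commutativeSemigroup

private
  variable
    m : ℕ
    f g A B : ℕ → ℤ

-- Finite sums of integers.

Σ< : ℕ → (ℕ → ℤ) → ℤ
Σ< zero    f = 0ℤ
Σ< (suc n) f = Σ< n f ℤ.+ f n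

Σ-cong : ∀ n → (∀ i → i < n → f i ≡ g i) → Σ< n f ≡ Σ< n g
Σ-cong zero    f≗g = refl
Σ-cong (suc n) f≗g =
  cong₂ ℤ._+_ (Σ-cong n λ i i<n → f≗g i (ℕ.m<n⇒m<1+n i<n)) (f≗g n ℕ.≤-refl)

Σ-cong-≗ : ∀ n → f ≗ g → Σ< n f ≡ Σ< n g
Σ-cong-≗ n f≗g = Σ-cong n λ i _ → f≗g i

Σ-+ : ∀ n f g → Σ< n (λ i → f i ℤ.+ g i) ≡ Σ< n f ℤ.+ Σ< n g
Σ-+ zero    f g = refl
Σ-+ (suc n) f g rewrite Σ-+ n f g = ℤ+.interchange (Σ< n f) (Σ< n g) (f n) (g n)

Σ-*ˡ : ∀ n a f → Σ< n (λ i → a ℤ.* f i) ≡ a ℤ.* Σ< n f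
Σ-*ˡ zero    a f = sym (ℤ.*-zeroʳ a)
Σ-*ˡ (suc n) a f rewrite Σ-*ˡ n a f = sym (ℤ.*-distribˡ-+ a _ _)

Σ-*ʳ : ∀ n a f → Σ< n (λ i → f i ℤ.* a) ≡ Σ< n f ℤ.* a
Σ-*ʳ n a f = begin
  Σ< n (λ i → f i ℤ.* a)  ≡⟨ Σ-cong-≗ n (λ i → ℤ.*-comm (f i) a) ⟩
  Σ< n (λ i → a ℤ.* f i)  ≡⟨ Σ-*ˡ n a f ⟩
  a ℤ.* Σ< n f            ≡⟨ ℤ.*-comm a _ ⟩
  Σ< n f ℤ.* a            ∎
  where open ≡-Reasoning

Σ-neg : ∀ n f → Σ< n (λ i → ℤ.- f i) ≡ ℤ.- Σ< n f
Σ-neg zero    f = refl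
Σ-neg (suc n) f rewrite Σ-neg n f = sym (ℤ.neg-distrib-+ (Σ< n f) (f n))

Σ-minus : ∀ n f g → Σ< n (λ i → f i ℤ.- g i) ≡ Σ< n f ℤ.- Σ< n g
Σ-minus n f g = trans (Σ-+ n f (λ i → ℤ.- g i)) (cong (ℤ._+_ (Σ< n f)) (Σ-neg n g))

Σ-const : ∀ n a → Σ< n (λ _ → a) ≡ + n ℤ.* a
Σ-const zero    a = sym (ℤ.*-zeroˡ a)
Σ-const (suc n) a rewrite Σ-const n a = trans (ℤ.+-comm _ a) (sym (ℤ.suc-* (+ n) a))

Σ-zero : ∀ n → Σ< n (λ _ → 0ℤ) ≡ 0ℤ
Σ-zero n = trans (Σ-const n 0ℤ) (ℤ.*-zeroʳ (+ n))

Σ-swap : ∀ m n (h : ℕ → ℕ → ℤ) →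
         Σ< m (λ i → Σ< n (h i)) ≡ Σ< n (λ j → Σ< m (λ i → h i j))
Σ-swap zero    n h = sym (Σ-zero n)
Σ-swap (suc m) n h rewrite Σ-swap m n h = sym (Σ-+ n _ (h m))

Σ-head : ∀ n f → Σ< (suc n) f ≡ f 0 ℤ.+ Σ< n (f ∘ suc)
Σ-head zero    f = ℤ.+-comm 0ℤ (f 0)
Σ-head (suc n) f rewrite Σ-head n f = ℤ.+-assoc (f 0) _ _

Σ-append : ∀ m n f → Σ< (m + n) f ≡ Σ< m f ℤ.+ Σ< n (λ i → f (m + i))
Σ-append m zero    f rewrite ℕ.+-identityʳ m = sym (ℤ.+-identityʳ _)
Σ-append m (suc n) f rewrite ℕ.+-suc m n | Σ-append m n f = ℤ.+-assoc (Σ< m f) _ _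

Σ-∣ : ∀ {d} n → (∀ i → i < n → d ℤ.∣ f i) → d ℤ.∣ Σ< n f
Σ-∣ zero    d∣f = ℤ.divides 0ℤ refl
Σ-∣ (suc n) d∣f = ℤ.∣m∣n⇒∣m+n (Σ-∣ n λ i i<n → d∣f i (ℕ.m<n⇒m<1+n i<n)) (d∣f n ℕ.≤-refl)

Σ-nonneg : ∀ n → (∀ i → i < n → 0ℤ ℤ.≤ f i) → 0ℤ ℤ.≤ Σ< n f
Σ-nonneg zero    0≤f = ℤ.≤-refl
Σ-nonneg (suc n) 0≤f =
  ℤ.+-mono-≤ (Σ-nonneg n λ i i<n → 0≤f i (ℕ.m<n⇒m<1+n i<n)) (0≤f n ℕ.≤-refl)

-- The sign condition leaves out the index 0, where the symbol of the operator may be negative.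
head≤Σ : ∀ n .{{_ : NonZero n}} → (∀ i → 0 < i → i < n → 0ℤ ℤ.≤ f i) → f 0 ℤ.≤ Σ< n f
head≤Σ {f} (suc n) 0≤f = begin
  f 0                        ≡⟨ ℤ.+-identityʳ (f 0) ⟨
  f 0 ℤ.+ 0ℤ                 ≤⟨ ℤ.+-monoʳ-≤ (f 0) (Σ-nonneg n λ i i<n → 0≤f (suc i) z<s (s<s i<n)) ⟩
  f 0 ℤ.+ Σ< n (f ∘ suc)     ≡⟨ Σ-head n f ⟨
  Σ< (suc n) f               ∎
  where open ℤ.≤-Reasoning

-- Periodic sequences and their cyclic correlation

Periodic : ℕ → (ℕ → ℤ) → Set
Periodic m f = ∀ v → f (v + m) ≡ f v

periodic-* : ∀ k → Periodic m f → Periodic (k * m) f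
periodic-* {m} {f} zero    per v = cong f (ℕ.+-identityʳ v)
periodic-* {m} {f} (suc k) per v = begin
  f (v + (m + k * m))  ≡⟨ cong f (ℕ.+-assoc v m (k * m)) ⟨
  f (v + m + k * m)    ≡⟨ periodic-* k per (v + m) ⟩
  f (v + m)            ≡⟨ per v ⟩
  f v                  ∎
  where open ≡-Reasoning

periodic-% : ∀ m .{{_ : NonZero m}} → Periodic m f → ∀ v → f (v % m) ≡ f v
periodic-% {f} m per v = begin
  f (v % m)                ≡⟨ periodic-* (v / m) per (v % m) ⟨
  f (v % m + v / m * m)    ≡⟨ cong f (m≡m%n+[m/n]*n v m) ⟨
  f v                      ∎
  where open ≡-Reasoning

Σ-shift : ∀ a → Periodic m f → Σ< m (λ i → f (a + i)) ≡ Σ< m f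
Σ-shift zero    per = refl
Σ-shift {m} {f} (suc a) per = begin
  Σ< m (λ i → f (suc a + i))            ≡⟨ Σ-cong-≗ m (λ i → cong f (sym (ℕ.+-suc a i))) ⟩
  Σ< m (f′ ∘ suc)                       ≡⟨ cancel (f′ 0) (Σ< m (f′ ∘ suc)) ⟨
  f′ 0 ℤ.+ Σ< m (f′ ∘ suc) ℤ.- f′ 0     ≡⟨ cong (ℤ._- f′ 0) (Σ-head m f′) ⟨
  Σ< m f′ ℤ.+ f′ m ℤ.- f′ 0             ≡⟨ cong (λ x → Σ< m f′ ℤ.+ x ℤ.- f′ 0) f′m≡f′0 ⟩
  Σ< m f′ ℤ.+ f′ 0 ℤ.- f′ 0             ≡⟨ cancel′ (f′ 0) (Σ< m f′) ⟩
  Σ< m f′                               ≡⟨ Σ-shift a per ⟩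
  Σ< m f                                ∎
  where
  open ≡-Reasoning
  f′ : ℕ → ℤ
  f′ i = f (a + i)
  f′m≡f′0 : f′ m ≡ f′ 0
  f′m≡f′0 = trans (per a) (cong f (sym (ℕ.+-identityʳ a)))
  cancel : ∀ x y → x ℤ.+ y ℤ.- x ≡ y
  cancel = ℤSolver.solve-∀
  cancel′ : ∀ x y → y ℤ.+ x ℤ.- x ≡ y
  cancel′ = ℤSolver.solve-∀

-- Push-forward along ℤ/(q m) → ℤ/m: summation over the fibres of the projection.
fold : ℕ → ℕ → (ℕ → ℤ) → ℕ → ℤ
fold q m f i = Σ< q (λ j → f (i + j * m))

fold-periodic : ∀ q m → Periodic (q * m) f → Periodic m (fold q m f)
fold-periodic {f} q m per v = begin
  Σ< q (λ j → f (v + m + j * m))    ≡⟨ Σ-cong-≗ q (λ j → cong f (ℕ.+-assoc v m (j * m))) ⟩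
  Σ< q (λ j → f (v + suc j * m))    ≡⟨ Σ-shift {m = q} 1 per′ ⟩
  Σ< q (λ j → f (v + j * m))        ∎
  where
  open ≡-Reasoning
  per′ : Periodic q (λ j → f (v + j * m))
  per′ j = begin
    f (v + (j + q) * m)        ≡⟨ cong (λ x → f (v + x)) (ℕ.*-distribʳ-+ m j q) ⟩
    f (v + (j * m + q * m))    ≡⟨ cong f (ℕ.+-assoc v (j * m) (q * m)) ⟨
    f (v + j * m + q * m)      ≡⟨ per (v + j * m) ⟩
    f (v + j * m)              ∎

Σ-fold : ∀ q m f → Σ< m (fold q m f) ≡ Σ< (q * m) f
Σ-fold zero    m f = Σ-zero m
Σ-fold (suc q) m f = begin
  Σ< m (λ i → fold q m f i ℤ.+ f (i + q * m))         ≡⟨ Σ-+ m (fold q m f) _ ⟩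
  Σ< m (fold q m f) ℤ.+ Σ< m (λ i → f (i + q * m))
    ≡⟨ cong₂ ℤ._+_ (Σ-fold q m f) (Σ-cong-≗ m λ i → cong f (ℕ.+-comm i (q * m))) ⟩
  Σ< (q * m) f ℤ.+ Σ< m (λ i → f (q * m + i))         ≡⟨ Σ-append (q * m) m f ⟨
  Σ< (q * m + m) f                                    ≡⟨ cong (λ x → Σ< x f) (ℕ.+-comm (q * m) m) ⟩
  Σ< (m + q * m) f                                    ∎
  where open ≡-Reasoning

Σ-periodic : ∀ q m → Periodic m f → Σ< (q * m) f ≡ + q ℤ.* Σ< m f
Σ-periodic {f} q m per = begin
  Σ< (q * m) f                 ≡⟨ Σ-fold q m f ⟨
  Σ< m (fold q m f)
    ≡⟨ Σ-cong-≗ m (λ i → trans (Σ-cong-≗ q λ j → periodic-* j per i) (Σ-const q (f i))) ⟩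
  Σ< m (λ i → + q ℤ.* f i)     ≡⟨ Σ-*ˡ m (+ q) f ⟩
  + q ℤ.* Σ< m f               ∎
  where open ≡-Reasoning

-- In the group ring of ℤ/m, the product of `B` with the reflection i ↦ -i of `A`; correlation
-- instead of convolution keeps all indices in ℕ.
corr : ℕ → (ℕ → ℤ) → (ℕ → ℤ) → ℕ → ℤ
corr m A B v = Σ< m (λ i → A i ℤ.* B (v + i))

-- The augmentation of the group ring is multiplicative.
Σ-corr : ∀ m A → Periodic m B → Σ< m (corr m A B) ≡ Σ< m A ℤ.* Σ< m B
Σ-corr {B} m A B-per = begin
  Σ< m (λ v → Σ< m (λ i → A i ℤ.* B (v + i)))   ≡⟨ Σ-swap m m _ ⟩
  Σ< m (λ i → Σ< m (λ v → A i ℤ.* B (v + i)))   ≡⟨ Σ-cong-≗ m (λ i → Σ-*ˡ m (A i) _) ⟩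
  Σ< m (λ i → A i ℤ.* Σ< m (λ v → B (v + i)))   ≡⟨ Σ-cong-≗ m (λ i → cong (A i ℤ.*_) (shifted i)) ⟩
  Σ< m (λ i → A i ℤ.* Σ< m B)                   ≡⟨ Σ-*ʳ m (Σ< m B) A ⟩
  Σ< m A ℤ.* Σ< m B                             ∎
  where
  open ≡-Reasoning
  shifted : ∀ i → Σ< m (λ v → B (v + i)) ≡ Σ< m B
  shifted i = trans (Σ-cong-≗ m λ v → cong B (ℕ.+-comm v i)) (Σ-shift i B-per)

-- When one factor has the smaller period m, only the projection of the other
-- factor to ℤ/m matters.
corr-foldˡ : ∀ q m A → Periodic m B → corr (q * m) A B ≗ corr m (fold q m A) B
corr-foldˡ {B} q m A B-per v = begin
  Σ< (q * m) (λ i → A i ℤ.* B (v + i))                                       ≡⟨ Σ-fold q m _ ⟨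
  Σ< m (λ i → Σ< q (λ j → A (i + j * m) ℤ.* B (v + (i + j * m))))
    ≡⟨ Σ-cong-≗ m (λ i → Σ-cong-≗ q λ j → cong (A (i + j * m) ℤ.*_) (drop i j)) ⟩
  Σ< m (λ i → Σ< q (λ j → A (i + j * m) ℤ.* B (v + i)))
    ≡⟨ Σ-cong-≗ m (λ i → Σ-*ʳ q (B (v + i)) _) ⟩
  Σ< m (λ i → fold q m A i ℤ.* B (v + i))                                    ∎
  where
  open ≡-Reasoning
  drop : ∀ i j → B (v + (i + j * m)) ≡ B (v + i)
  drop i j = trans (cong B (sym (ℕ.+-assoc v i (j * m)))) (periodic-* j B-per (v + i))

corr-foldʳ : ∀ q m B → Periodic m A → corr (q * m) A B ≗ corr m A (fold q m B)
corr-foldʳ {A} q m B A-per v = begin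
  Σ< (q * m) (λ i → A i ℤ.* B (v + i))                                ≡⟨ Σ-fold q m _ ⟨
  Σ< m (λ i → Σ< q (λ j → A (i + j * m) ℤ.* B (v + (i + j * m))))
    ≡⟨ Σ-cong-≗ m (λ i → Σ-cong-≗ q λ j →
         cong₂ ℤ._*_ (periodic-* j A-per i) (cong B (sym (ℕ.+-assoc v i (j * m))))) ⟩
  Σ< m (λ i → Σ< q (λ j → A i ℤ.* B (v + i + j * m)))
    ≡⟨ Σ-cong-≗ m (λ i → Σ-*ˡ q (A i) _) ⟩
  Σ< m (λ i → A i ℤ.* fold q m B (v + i))                             ∎
  where open ≡-Reasoning

corr-congˡ : ∀ m {A A′} B → A ≗ A′ → corr m A B ≗ corr m A′ B
corr-congˡ m B A≗A′ v = Σ-cong-≗ m λ i → cong (ℤ._* B (v + i)) (A≗A′ i)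

corr-congʳ : ∀ m A {B B′} → B ≗ B′ → corr m A B ≗ corr m A B′
corr-congʳ m A B≗B′ v = Σ-cong-≗ m λ i → cong (A i ℤ.*_) (B≗B′ (v + i))

corr-+ˡ : ∀ m A A′ B v → corr m (λ i → A i ℤ.+ A′ i) B v ≡ corr m A B v ℤ.+ corr m A′ B v
corr-+ˡ m A A′ B v =
  trans (Σ-cong-≗ m λ i → ℤ.*-distribʳ-+ (B (v + i)) (A i) (A′ i)) (Σ-+ m _ _)

corr-+ʳ : ∀ m A B B′ v → corr m A (λ i → B i ℤ.+ B′ i) v ≡ corr m A B v ℤ.+ corr m A B′ v
corr-+ʳ m A B B′ v =
  trans (Σ-cong-≗ m λ i → ℤ.*-distribˡ-+ (A i) (B (v + i)) (B′ (v + i))) (Σ-+ m _ _)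

corr-periodicʳ : ∀ m A {k} → Periodic k B → Periodic k (corr m A B)
corr-periodicʳ {B} m A {k} per v = Σ-cong-≗ m λ i →
  cong (A i ℤ.*_) (trans (cong B (ℕ+.xy∙z≈xz∙y v k i)) (per (v + i)))

corr-periodicˡ : ∀ q m → Periodic m A → Periodic (q * m) B → Periodic m (corr (q * m) A B)
corr-periodicˡ {A} {B} q m A-per B-per v = begin
  corr (q * m) A B (v + m)           ≡⟨ corr-foldʳ q m B A-per (v + m) ⟩
  corr m A (fold q m B) (v + m)      ≡⟨ corr-periodicʳ m A (fold-periodic q m B-per) v ⟩
  corr m A (fold q m B) v            ≡⟨ corr-foldʳ q m B A-per v ⟨
  corr (q * m) A B v                 ∎
  where open ≡-Reasoning

-- Differences

-- The division-free form of C(n+1, k+1) = (n+1)/(k+1) · C(n, k). For n + 1 = q^s it makes q^s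
-- divide the left-hand side.
absorption : ∀ n k → suc k * (suc n C suc k) ≡ suc n * (n C k)
absorption zero    zero    = refl
absorption zero    (suc k) = ℕ.*-zeroʳ (suc (suc k))
absorption (suc n) zero    = trans (ℕ.*-identityˡ _) (trans (nC1≡n (suc (suc n))) (sym (ℕ.*-identityʳ _)))
absorption (suc n) (suc k) = begin
  suc (suc k) * (suc (suc n) C suc (suc k))
    ≡⟨ cong (suc (suc k) *_) (nCk+nC[k+1]≡[n+1]C[k+1] (suc n) (suc k)) ⟨
  suc (suc k) * (x + y)                        ≡⟨ split (suc k) x y ⟩
  x + (suc k * x + suc (suc k) * y)
    ≡⟨ cong (λ z → x + z) (cong₂ _+_ (absorption n k) (absorption n (suc k))) ⟩
  x + (suc n * (n C k) + suc n * (n C suc k))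
    ≡⟨ cong (λ z → x + z) (ℕ.*-distribˡ-+ (suc n) (n C k) (n C suc k)) ⟨
  x + suc n * (n C k + n C suc k)
    ≡⟨ cong (λ z → x + suc n * z) (nCk+nC[k+1]≡[n+1]C[k+1] n k) ⟩
  suc (suc n) * x                              ∎
  where
  open ≡-Reasoning
  x = suc n C suc k
  y = suc n C suc (suc k)
  split : ∀ a x y → suc a * (x + y) ≡ x + (a * x + suc a * y)
  split = ℕSolver.solve-∀

-- With x the shift of sequences, `D` is the action of x - 1 and, below, `Δ m` that of x^m - 1,
-- whose kernel consists of the sequences of period m.
D : (ℕ → ℤ) → ℕ → ℤ
D f v = f (suc v) ℤ.- f v

D^ : ℕ → (ℕ → ℤ) → ℕ → ℤ
D^ zero    f = f
D^ (suc n) f = D (D^ n f)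

Δ : ℕ → (ℕ → ℤ) → ℕ → ℤ
Δ m f v = f (v + m) ℤ.- f v

D^-+ : ∀ m n f → D^ (m + n) f ≡ D^ m (D^ n f)
D^-+ zero    n f = refl
D^-+ (suc m) n f = cong D (D^-+ m n f)

D-cong : f ≗ g → D f ≗ D g
D-cong f≗g v = cong₂ ℤ._-_ (f≗g (suc v)) (f≗g v)

D^-periodic : ∀ n → Periodic m f → Periodic m (D^ n f)
D^-periodic zero    per = per
D^-periodic (suc n) per v = cong₂ ℤ._-_ (D^-periodic n per (suc v)) (D^-periodic n per v)

D^-∣ : ∀ {d} n → (∀ v → d ℤ.∣ f v) → ∀ v → d ℤ.∣ D^ n f v
D^-∣ zero    d∣f   = d∣f
D^-∣ (suc n) d∣f v = ℤ.∣m∣n⇒∣m-n (D^-∣ n d∣f (suc v)) (D^-∣ n d∣f v)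

-- The shift is 1 + D; its n-th power expands by the binomial theorem.
newton : ∀ n f v → Σ< (suc n) (λ k → + (n C k) ℤ.* D^ k f v) ≡ f (v + n)
newton zero    f v = begin
  0ℤ ℤ.+ 1ℤ ℤ.* f v  ≡⟨ trans (ℤ.+-identityˡ _) (ℤ.*-identityˡ _) ⟩
  f v                ≡⟨ cong f (ℕ.+-identityʳ v) ⟨
  f (v + 0)          ∎
  where open ≡-Reasoning
newton (suc n) f v = begin
  Σ< (2 + n) (λ k → + (suc n C k) ℤ.* D^ k f v)
    ≡⟨ Σ-head (suc n) _ ⟩
  1f ℤ.+ Σ< (suc n) (λ k → + (suc n C suc k) ℤ.* D^ (suc k) f v)
    ≡⟨ cong (ℤ._+_ 1f) (trans (Σ-cong-≗ (suc n) pascal) (Σ-+ (suc n) a b)) ⟩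
  1f ℤ.+ (Σ< (suc n) a ℤ.+ Σ< (suc n) b)
    ≡⟨ ℤ+.x∙yz≈y∙xz 1f (Σ< (suc n) a) (Σ< (suc n) b) ⟩
  Σ< (suc n) a ℤ.+ (1f ℤ.+ Σ< (suc n) b)
    ≡⟨ cong (ℤ._+_ (Σ< (suc n) a)) (Σ-head (suc n) b′) ⟨
  Σ< (suc n) a ℤ.+ (Σ< (suc n) b′ ℤ.+ b′ (suc n))
    ≡⟨ cong (λ x → Σ< (suc n) a ℤ.+ (Σ< (suc n) b′ ℤ.+ x)) b′-top ⟩
  Σ< (suc n) a ℤ.+ (Σ< (suc n) b′ ℤ.+ 0ℤ)
    ≡⟨ cong (ℤ._+_ (Σ< (suc n) a)) (ℤ.+-identityʳ _) ⟩
  Σ< (suc n) a ℤ.+ Σ< (suc n) b′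
    ≡⟨ Σ-+ (suc n) a b′ ⟨
  Σ< (suc n) (λ k → a k ℤ.+ b′ k)
    ≡⟨ Σ-cong-≗ (suc n) (λ k → combine (+ (n C k)) (D^ k f (suc v)) (D^ k f v)) ⟩
  Σ< (suc n) (λ k → + (n C k) ℤ.* D^ k f (suc v))
    ≡⟨ newton n f (suc v) ⟩
  f (suc (v + n))
    ≡⟨ cong f (ℕ.+-suc v n) ⟨
  f (v + suc n)
    ∎
  where
  open ≡-Reasoning
  1f = 1ℤ ℤ.* f v
  a b b′ : ℕ → ℤ
  a k  = + (n C k) ℤ.* D^ (suc k) f v
  b k  = + (n C suc k) ℤ.* D^ (suc k) f v
  b′ k = + (n C k) ℤ.* D^ k f v
  pascal : (λ k → + (suc n C suc k) ℤ.* D^ (suc k) f v) ≗ (λ k → a k ℤ.+ b k)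
  pascal k = trans
    (cong (λ x → + x ℤ.* D^ (suc k) f v) (sym (nCk+nC[k+1]≡[n+1]C[k+1] n k)))
    (ℤ.*-distribʳ-+ (D^ (suc k) f v) (+ (n C k)) (+ (n C suc k)))
  b′-top : b′ (suc n) ≡ 0ℤ
  b′-top = cong (λ x → + x ℤ.* D^ (suc n) f v) (k>n⇒nCk≡0 {n} ℕ.≤-refl)
  combine : ∀ c x y → c ℤ.* (x ℤ.- y) ℤ.+ c ℤ.* y ≡ c ℤ.* x
  combine = ℤSolver.solve-∀

corr-Dʳ : ∀ m A B → corr m A (D B) ≗ D (corr m A B)
corr-Dʳ m A B v = trans
  (Σ-cong-≗ m λ i → distrib (A i) (B (suc v + i)) (B (v + i)))
  (Σ-minus m _ _)
  where
  distrib : ∀ x y z → x ℤ.* (y ℤ.- z) ≡ x ℤ.* y ℤ.- x ℤ.* z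
  distrib = ℤSolver.solve-∀

-- Summation by parts. Shifting `A` forwards moves `B` backwards, whence the sign; evaluation at
-- `suc v` keeps the index of `B` natural.
corr-Dˡ : Periodic m A → Periodic m B → ∀ v → corr m (D A) B (suc v) ≡ ℤ.- D (corr m A B) v
corr-Dˡ {m} {A} {B} A-per B-per v = begin
  Σ< m (λ i → (A (suc i) ℤ.- A i) ℤ.* B (suc v + i))
    ≡⟨ Σ-cong-≗ m (λ i → trans (distrib (A (suc i)) (A i) (B (suc v + i)))
                              (cong (λ x → A (suc i) ℤ.* B x ℤ.- A i ℤ.* B (suc v + i)) (sym (ℕ.+-suc v i)))) ⟩
  Σ< m (λ i → h (suc i) ℤ.- A i ℤ.* B (suc v + i))
    ≡⟨ Σ-minus m (h ∘ suc) _ ⟩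
  Σ< m (h ∘ suc) ℤ.- corr m A B (suc v)
    ≡⟨ cong (ℤ._- corr m A B (suc v)) (Σ-shift 1 h-per) ⟩
  corr m A B v ℤ.- corr m A B (suc v)
    ≡⟨ negate (corr m A B v) (corr m A B (suc v)) ⟩
  ℤ.- D (corr m A B) v
    ∎
  where
  open ≡-Reasoning
  h : ℕ → ℤ
  h i = A i ℤ.* B (v + i)
  h-per : Periodic m h
  h-per i = cong₂ ℤ._*_ (A-per i) (trans (cong B (sym (ℕ.+-assoc v i m))) (B-per (v + i)))
  distrib : ∀ x y z → (x ℤ.- y) ℤ.* z ≡ x ℤ.* z ℤ.- y ℤ.* z
  distrib = ℤSolver.solve-∀
  negate : ∀ x y → x ℤ.- y ≡ ℤ.- (y ℤ.- x)
  negate = ℤSolver.solve-∀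

-- If D g has period m then g increases by a constant over every period; an
-- actual period q * m forces that constant to vanish.
D-periodic⇒periodic : ∀ q m .{{_ : NonZero q}} →
                      Periodic (q * m) g → Periodic m (D g) → Periodic m g
D-periodic⇒periodic {g} q m g-per Dg-per v =
  ℤ.i-j≡0⇒i≡j (g (v + m)) (g v) (trans (constant v) κ≡0)
  where
  open ≡-Reasoning
  κ = Δ m g 0
  constant : ∀ v → Δ m g v ≡ κ
  constant zero    = refl
  constant (suc v) = trans (rearrange (g (suc v + m)) (g (v + m)) (g (suc v)) (g v) (Dg-per v)) (constant v)
    where
    rearrange : ∀ x y z w → x ℤ.- y ≡ z ℤ.- w → x ℤ.- z ≡ y ℤ.- w
    rearrange x y z w eq = begin
      x ℤ.- z                     ≡⟨ lemma x y z ⟩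
      (x ℤ.- y) ℤ.+ (y ℤ.- z)     ≡⟨ cong (ℤ._+ (y ℤ.- z)) eq ⟩
      (z ℤ.- w) ℤ.+ (y ℤ.- z)     ≡⟨ lemma′ y z w ⟩
      y ℤ.- w                     ∎
      where
      lemma : ∀ x y z → x ℤ.- z ≡ (x ℤ.- y) ℤ.+ (y ℤ.- z)
      lemma = ℤSolver.solve-∀
      lemma′ : ∀ y z w → (z ℤ.- w) ℤ.+ (y ℤ.- z) ≡ y ℤ.- w
      lemma′ = ℤSolver.solve-∀
  increments : ∀ j v → g (v + j * m) ≡ g v ℤ.+ + j ℤ.* κ
  increments zero    v = trans (cong g (ℕ.+-identityʳ v)) (sym (ℤ.+-identityʳ (g v)))
  increments (suc j) v = begin
    g (v + (m + j * m))               ≡⟨ cong g (ℕ.+-assoc v m (j * m)) ⟨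
    g (v + m + j * m)                 ≡⟨ increments j (v + m) ⟩
    g (v + m) ℤ.+ + j ℤ.* κ           ≡⟨ lemma (g (v + m)) (g v) (+ j ℤ.* κ) ⟩
    g v ℤ.+ (Δ m g v ℤ.+ + j ℤ.* κ)   ≡⟨ cong (λ x → g v ℤ.+ (x ℤ.+ + j ℤ.* κ)) (constant v) ⟩
    g v ℤ.+ (κ ℤ.+ + j ℤ.* κ)         ≡⟨ cong (ℤ._+_ (g v)) (ℤ.suc-* (+ j) κ) ⟨
    g v ℤ.+ + suc j ℤ.* κ             ∎
    where
    lemma : ∀ x y z → x ℤ.+ z ≡ y ℤ.+ ((x ℤ.- y) ℤ.+ z)
    lemma = ℤSolver.solve-∀
  κ≡0 : κ ≡ 0ℤ
  κ≡0 = ℤ.*-cancelˡ-≡ (+ q) κ 0ℤ (begin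
    + q ℤ.* κ                     ≡⟨ lemma (g 0) (+ q ℤ.* κ) ⟩
    g 0 ℤ.+ + q ℤ.* κ ℤ.- g 0     ≡⟨ ℤ.i≡j⇒i-j≡0 (trans (sym (increments q 0)) (g-per 0)) ⟩
    0ℤ                            ≡⟨ ℤ.*-zeroʳ (+ q) ⟨
    + q ℤ.* 0ℤ                    ∎)
    where
    lemma : ∀ x y → y ≡ x ℤ.+ y ℤ.- x
    lemma = ℤSolver.solve-∀

-- Correcting the partial sums of A by a multiple of ⌊v/m⌋ makes them periodic.
antidifference : ∀ q m .{{_ : NonZero m}} → Periodic (q * m) A → + q ℤ.∣ Σ< (q * m) A →
                 ∃[ u ] ∃[ w ] Periodic (q * m) u × Periodic m w × (∀ v → A v ≡ D u v ℤ.+ w v)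
antidifference {A} q m A-per (ℤ.divides e ΣA≡eq) = u , w , u-per , w-per , λ v →
  lemma (Σ< v A) (A v) (e ℤ.* + (suc v / m)) e (+ (suc v / m)) (+ (v / m))
  where
  open ≡-Reasoning
  u w : ℕ → ℤ
  u v = Σ< v A ℤ.- e ℤ.* + (v / m)
  w v = e ℤ.* (+ (suc v / m) ℤ.- + (v / m))
  lemma : ∀ s a x e y z → a ≡ (s ℤ.+ a ℤ.- e ℤ.* y ℤ.- (s ℤ.- e ℤ.* z)) ℤ.+ e ℤ.* (y ℤ.- z)
  lemma = ℤSolver.solve-∀
  u-per : Periodic (q * m) u
  u-per v = begin
    Σ< (v + q * m) A ℤ.- e ℤ.* + ((v + q * m) / m)
      ≡⟨ cong₂ (λ x y → x ℤ.- e ℤ.* + y) (Σ-append v (q * m) A)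
               (trans (+-distrib-/-∣ʳ v (ℕ.n∣m*n q)) (cong (λ x → v / m + x) (m*n/n≡m q m))) ⟩
    Σ< v A ℤ.+ Σ< (q * m) (λ i → A (v + i)) ℤ.- e ℤ.* + (v / m + q)
      ≡⟨ cong (λ x → Σ< v A ℤ.+ x ℤ.- e ℤ.* + (v / m + q)) (trans (Σ-shift v A-per) ΣA≡eq) ⟩
    Σ< v A ℤ.+ e ℤ.* + q ℤ.- e ℤ.* (+ (v / m) ℤ.+ + q)
      ≡⟨ cancel (Σ< v A) e (+ q) (+ (v / m)) ⟩
    u v ∎
    where
    cancel : ∀ s e q x → s ℤ.+ e ℤ.* q ℤ.- e ℤ.* (x ℤ.+ q) ≡ s ℤ.- e ℤ.* x
    cancel = ℤSolver.solve-∀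
  /-suc : ∀ v → (v + m) / m ≡ v / m + 1
  /-suc v = trans (+-distrib-/-∣ʳ v ℕ.∣-refl) (cong (λ x → v / m + x) (n/n≡1 m))
  w-per : Periodic m w
  w-per v = begin
    e ℤ.* (+ ((suc v + m) / m) ℤ.- + ((v + m) / m))
      ≡⟨ cong₂ (λ x y → e ℤ.* (+ x ℤ.- + y)) (/-suc (suc v)) (/-suc v) ⟩
    e ℤ.* ((+ (suc v / m) ℤ.+ 1ℤ) ℤ.- (+ (v / m) ℤ.+ 1ℤ))
      ≡⟨ cancel e (+ (suc v / m)) (+ (v / m)) ⟩
    w v                                                        ∎
    where
    cancel : ∀ e x y → e ℤ.* ((x ℤ.+ 1ℤ) ℤ.- (y ℤ.+ 1ℤ)) ≡ e ℤ.* (x ℤ.- y)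
    cancel = ℤSolver.solve-∀

-- Division of a factor of a correlation by x - 1.

module _ (q m : ℕ) .{{_ : NonZero q}} where

  -- Division by x - 1 preserves the hypothesis of the descent: up to sign and a shift, D (corr u B)
  -- is corr A B minus corr w B, and both of these have period m. As corr u B has period q m, it
  -- inherits the period m from its difference.
  corr-antidifferenceˡ : ∀ {A B u w} → Periodic (q * m) B →
    Periodic (q * m) u → Periodic m w → (∀ v → A v ≡ D u v ℤ.+ w v) →
    Periodic m (corr (q * m) A B) → Periodic m (corr (q * m) u B)
  corr-antidifferenceˡ {A} {B} {u} {w} B-per u-per w-per A≗ AB-per =
    D-periodic⇒periodic q m (corr-periodicʳ (q * m) u B-per) λ v →
      trans (D-expand (v + m)) (trans
        (cong₂ (λ x y → y ℤ.- x) (AB-per (suc v)) (corr-periodicˡ q m w-per B-per (suc v)))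
        (sym (D-expand v)))
    where
    open ≡-Reasoning
    D-expand : ∀ v → D (corr (q * m) u B) v ≡ corr (q * m) w B (suc v) ℤ.- corr (q * m) A B (suc v)
    D-expand v = begin
      D uB v
        ≡⟨ lemma (D uB v) (corr (q * m) w B (suc v)) ⟩
      wB ℤ.- (ℤ.- D uB v ℤ.+ wB)
        ≡⟨ cong (λ x → wB ℤ.- (x ℤ.+ wB)) (corr-Dˡ u-per B-per v) ⟨
      wB ℤ.- (corr (q * m) (D u) B (suc v) ℤ.+ wB)
        ≡⟨ cong (ℤ._-_ wB) (corr-+ˡ (q * m) (D u) w B (suc v)) ⟨
      wB ℤ.- corr (q * m) (λ i → D u i ℤ.+ w i) B (suc v)
        ≡⟨ cong (ℤ._-_ wB) (corr-congˡ (q * m) B A≗ (suc v)) ⟨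
      wB ℤ.- corr (q * m) A B (suc v)                     ∎
      where
      uB = corr (q * m) u B
      wB = corr (q * m) w B (suc v)
      lemma : ∀ x y → x ≡ y ℤ.- (ℤ.- x ℤ.+ y)
      lemma = ℤSolver.solve-∀

  corr-antidifferenceʳ : ∀ {A B u w} →
    Periodic (q * m) u → Periodic m w → (∀ v → B v ≡ D u v ℤ.+ w v) →
    Periodic m (corr (q * m) A B) → Periodic m (corr (q * m) A u)
  corr-antidifferenceʳ {A} {B} {u} {w} u-per w-per B≗ AB-per =
    D-periodic⇒periodic q m (corr-periodicʳ (q * m) A u-per) λ v →
      trans (D-expand (v + m)) (trans
        (cong₂ ℤ._-_ (AB-per v) (corr-periodicʳ (q * m) A w-per v))
        (sym (D-expand v)))
    where
    open ≡-Reasoning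
    D-expand : ∀ v → D (corr (q * m) A u) v ≡ corr (q * m) A B v ℤ.- corr (q * m) A w v
    D-expand v = begin
      D Au v                                                       ≡⟨ lemma (D Au v) Aw ⟩
      D Au v ℤ.+ Aw ℤ.- Aw
        ≡⟨ cong (λ x → x ℤ.+ Aw ℤ.- Aw) (corr-Dʳ (q * m) A u v) ⟨
      corr (q * m) A (D u) v ℤ.+ Aw ℤ.- Aw
        ≡⟨ cong (ℤ._- Aw) (corr-+ʳ (q * m) A (D u) w v) ⟨
      corr (q * m) A (λ i → D u i ℤ.+ w i) v ℤ.- Aw
        ≡⟨ cong (ℤ._- Aw) (corr-congʳ (q * m) A B≗ v) ⟨
      corr (q * m) A B v ℤ.- Aw                                    ∎
      where
      Au = corr (q * m) A u
      Aw = corr (q * m) A w v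
      lemma : ∀ x y → x ≡ x ℤ.+ y ℤ.- y
      lemma = ℤSolver.solve-∀

bounded : ∀ m .{{_ : NonZero m}} → Periodic m f → ∃[ K ] ∀ v → ℤ.∣ f v ∣ ≤ K
bounded {f} m per with initial m
  where
  initial : ∀ n → ∃[ K ] ∀ i → i < n → ℤ.∣ f i ∣ ≤ K
  initial zero    = 0 , λ _ ()
  initial (suc n) with initial n
  ... | K , ≤K = K ⊔ ℤ.∣ f n ∣ , λ i i<1+n → case i (ℕ.m≤n⇒m<n∨m≡n (ℕ.≤-pred i<1+n))
    where
    case : ∀ i → i < n ⊎ i ≡ n → ℤ.∣ f i ∣ ≤ K ⊔ ℤ.∣ f n ∣
    case i (inj₁ i<n)  = ℕ.≤-trans (≤K i i<n) (ℕ.m≤m⊔n K _)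
    case i (inj₂ refl) = ℕ.m≤n⊔m K _
... | K , ≤K = K , λ v → subst (λ x → ℤ.∣ x ∣ ≤ K) (periodic-% m per v) (≤K (v % m) (m%n<n v m))

small∧∣⇒≡0 : ∀ {d x} → ℤ.∣ x ∣ < d → + d ℤ.∣ x → x ≡ 0ℤ
small∧∣⇒≡0 {d} {x} x<d d∣x = ℤ.∣i∣≡0⇒i≡0 (vanish ℤ.∣ x ∣ x<d (ℤ.∣⇒∣ᵤ d∣x))
  where
  vanish : ∀ n → n < d → d ∣ n → n ≡ 0
  vanish zero    _   _   = refl
  vanish (suc n) n<d d∣n = contradiction d∣n (ℕ.>⇒∤ n<d)

Δ-periodic : ∀ k → Periodic m f → Periodic m (Δ k f)
Δ-periodic {m} {f} k per v = cong₂ ℤ._-_ (trans (cong f (ℕ+.xy∙z≈xz∙y v m k)) (per (v + k))) (per v)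

-- `Δ m` annihilates the m-periodic `w` and commutes with `D`.
Δ-antidifference : ∀ {u w} → Periodic m w → (∀ v → A v ≡ D u v ℤ.+ w v) → Δ m A ≗ D (Δ m u)
Δ-antidifference {m} {A} {u} {w} w-per A≗ v = begin
  A (v + m) ℤ.- A v                                   ≡⟨ cong₂ ℤ._-_ (A≗ (v + m)) (A≗ v) ⟩
  D u (v + m) ℤ.+ w (v + m) ℤ.- (D u v ℤ.+ w v)
    ≡⟨ cong (λ x → D u (v + m) ℤ.+ x ℤ.- (D u v ℤ.+ w v)) (w-per v) ⟩
  D u (v + m) ℤ.+ w v ℤ.- (D u v ℤ.+ w v)
    ≡⟨ lemma (u (suc v + m)) (u (v + m)) (u (suc v)) (u v) (w v) ⟩
  D (Δ m u) v                                         ∎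
  where
  open ≡-Reasoning
  lemma : ∀ a b c d w → a ℤ.- b ℤ.+ w ℤ.- (c ℤ.- d ℤ.+ w) ≡ a ℤ.- c ℤ.- (b ℤ.- d)
  lemma = ℤSolver.solve-∀

-- Primality of the cyclotomic ideal.

module _ {q : ℕ} (q-prime : Prime q) where

  private instance
    q-nonZero : NonZero q
    q-nonZero = prime⇒nonZero q-prime

  1<q : 1 < q
  1<q = nonTrivial⇒n>1 q {{prime⇒nonTrivial q-prime}}

  n<q^n : ∀ n → n < q ^ n
  n<q^n zero    = z<s
  n<q^n (suc n) = ℕ.<-≤-trans (s<s (n<q^n n)) (ℕ.^-monoʳ-< q 1<q {n} {suc n} ℕ.≤-refl)

  prime-power-cancelʳ : ∀ s k x → ¬ q ∣ x → q ^ s ∣ k * x → q ^ s ∣ k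
  prime-power-cancelʳ zero    k x q∤x _ = ℕ.1∣ k
  prime-power-cancelʳ (suc s) k x q∤x q^∣kx
    with euclidsLemma k x q-prime (ℕ.m*n∣⇒m∣ q (q ^ s) q^∣kx)
  ... | inj₂ q∣x = contradiction q∣x q∤x
  ... | inj₁ (divides k′ refl) = subst (q * q ^ s ∣_) (ℕ.*-comm q k′) (ℕ.*-monoʳ-∣ q
    (prime-power-cancelʳ s k′ x q∤x (ℕ.*-cancelˡ-∣ q (subst (q * q ^ s ∣_) (reorder k′ q x) q^∣kx))))
    where
    reorder : ∀ a b c → a * b * c ≡ b * (a * c)
    reorder = ℕSolver.solve-∀

  euclidsLemma-ℤ : ∀ x y → + q ℤ.∣ x ℤ.* y → + q ℤ.∣ x ⊎ + q ℤ.∣ y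
  euclidsLemma-ℤ x y q∣xy
    with euclidsLemma ℤ.∣ x ∣ ℤ.∣ y ∣ q-prime (subst (q ∣_) (ℤ.abs-* x y) (ℤ.∣⇒∣ᵤ q∣xy))
  ... | inj₁ q∣x = inj₁ (ℤ.∣ᵤ⇒∣ q∣x)
  ... | inj₂ q∣y = inj₂ (ℤ.∣ᵤ⇒∣ q∣y)

  -- Otherwise absorption and cancellation of the binomial coefficient would make q^s a divisor of k
  -- + 1, which is positive and smaller than q^s.
  q∣q^sCk : ∀ s {N k} → suc N ≡ q ^ s → k < N → q ∣ suc N C suc k
  q∣q^sCk s {N} {k} N≡ k<N with q ℕ.∣? (suc N C suc k)
  ... | yes q∣C = q∣C
  ... | no  q∤C = contradiction
    (prime-power-cancelʳ s (suc k) (suc N C suc k) q∤C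
      (subst (_∣ suc k * (suc N C suc k)) N≡
        (divides (N C k) (trans (absorption N k) (ℕ.*-comm (suc N) _)))))
    (ℕ.>⇒∤ (subst (suc k <_) N≡ (s<s k<N)))

  -- The Frobenius identity (1 + D)^(q^s) ≡ 1 + D^(q^s) mod q. As the shift by q^s acts trivially on
  -- `f`, D^(q^s) f is minus the sum of the intermediate terms, each of which gains a factor q from
  -- its binomial coefficient and keeps the divisor `d`.
  D^-∣-step : ∀ s {d} → Periodic (q ^ s) f → (∀ v → d ℤ.∣ f v) → ∀ v → + q ℤ.* d ℤ.∣ D^ (q ^ s) f v
  D^-∣-step {f} s {d} per d∣f v = go (q ^ s) {{m^n≢0 q s}} refl
    where
    open ≡-Reasoning
    -- A variable in place of `q ^ s` can be matched as a successor.
    go : ∀ M .{{_ : NonZero M}} → M ≡ q ^ s → + q ℤ.* d ℤ.∣ D^ M f v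
    go (suc N) N≡ = subst (+ q ℤ.* d ℤ.∣_) D^≡ (ℤ.∣m⇒∣-m (Σ-∣ N λ k k<N →
      ℤ.∣-trans (ℤ.*-monoʳ-∣ (+ q) (D^-∣ (suc k) d∣f v))
                (ℤ.*-monoˡ-∣ (D^ (suc k) f v) {+ q} {+ (suc N C suc k)} (ℤ.∣ᵤ⇒∣ (q∣q^sCk s N≡ k<N)))))
      where
      t : ℕ → ℤ
      t k = + (suc N C k) ℤ.* D^ k f v
      S = Σ< N (t ∘ suc)
      top : t (suc N) ≡ D^ (suc N) f v
      top = trans (cong (λ x → + x ℤ.* D^ (suc N) f v) (nCn≡1 (suc N))) (ℤ.*-identityˡ _)
      expansion : 1ℤ ℤ.* f v ℤ.+ S ℤ.+ D^ (suc N) f v ≡ f v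
      expansion = begin
        t 0 ℤ.+ S ℤ.+ D^ (suc N) f v    ≡⟨ cong₂ ℤ._+_ (Σ-head N t) top ⟨
        Σ< (2 + N) t                    ≡⟨ newton (suc N) f v ⟩
        f (v + suc N)                   ≡⟨ cong (λ M → f (v + M)) N≡ ⟩
        f (v + q ^ s)                   ≡⟨ per v ⟩
        f v                             ∎
      D^≡ : ℤ.- S ≡ D^ (suc N) f v
      D^≡ = begin
        ℤ.- S                                                      ≡⟨ lemma (f v) S ⟩
        f v ℤ.- (1ℤ ℤ.* f v ℤ.+ S)
          ≡⟨ cong (ℤ._- (1ℤ ℤ.* f v ℤ.+ S)) expansion ⟨
        1ℤ ℤ.* f v ℤ.+ S ℤ.+ D^ (suc N) f v ℤ.- (1ℤ ℤ.* f v ℤ.+ S)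
          ≡⟨ lemma′ (1ℤ ℤ.* f v ℤ.+ S) (D^ (suc N) f v) ⟩
        D^ (suc N) f v                                             ∎
        where
        lemma : ∀ x y → ℤ.- y ≡ x ℤ.- (1ℤ ℤ.* x ℤ.+ y)
        lemma = ℤSolver.solve-∀
        lemma′ : ∀ x y → x ℤ.+ y ℤ.- x ≡ y
        lemma′ = ℤSolver.solve-∀

  q^M∣D^ : ∀ s M → Periodic (q ^ s) f → ∀ v → + (q ^ M) ℤ.∣ D^ (M * q ^ s) f v
  q^M∣D^ {f} s zero    per v = ℤ.divides (f v) (sym (ℤ.*-identityʳ (f v)))
  q^M∣D^ {f} s (suc M) per v
    rewrite D^-+ (q ^ s) (M * q ^ s) f | ℤ.pos-* q (q ^ M) =
    D^-∣-step s (D^-periodic (M * q ^ s) per) (q^M∣D^ s M per) v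

  module _ (s : ℕ) where

    private
      m′ = q ^ s
      instance
        m′-nonZero : NonZero m′
        m′-nonZero = m^n≢0 q s

    -- The ideal of the m′-periodic sequences is the q^(s+1)-th cyclotomic one, and
    -- the proof that it is prime is by infinite descent along the element x − 1:
    -- it divides everything with sum ≡ 0 mod q, and its powers eventually
    -- contribute arbitrarily many factors q.
    descent : ∀ i j {A B} → Periodic (q * m′) A → Periodic (q * m′) B →
              Periodic m′ (corr (q * m′) A B) →
              (∃[ u ] Periodic (q * m′) u × Δ m′ A ≗ D^ i u) ⊎
              (∃[ u ] Periodic (q * m′) u × Δ m′ B ≗ D^ j u)
    descent zero    j       {A} {B} A-per B-per AB-per = inj₁ (Δ m′ A , Δ-periodic m′ A-per , λ _ → refl)
    descent (suc i) zero    {A} {B} A-per B-per AB-per = inj₂ (Δ m′ B , Δ-periodic m′ B-per , λ _ → refl)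
    descent (suc i) (suc j) {A} {B} A-per B-per AB-per
      -- The correlation has sum ΣA · ΣB over the length q m′, and it has period m′. So q divides
      -- this product and hence a factor, which is then divided by x - 1.
      with euclidsLemma-ℤ (Σ< (q * m′) A) (Σ< (q * m′) B)
             (ℤ.divides (Σ< m′ (corr (q * m′) A B))
               (trans (sym (Σ-corr (q * m′) A B-per)) (trans (Σ-periodic q m′ AB-per) (ℤ.*-comm (+ q) _))))
    ... | inj₁ q∣ΣA with antidifference q m′ A-per q∣ΣA
    ...   | u , w , u-per , w-per , A≗
      with descent i (suc j) u-per B-per (corr-antidifferenceˡ q m′ {B = B} {u = u} B-per u-per w-per A≗ AB-per)
    ...     | inj₁ (u′ , u′-per , Δu≗) = inj₁
      (u′ , u′-per , λ v → trans (Δ-antidifference {A = A} {u = u} w-per A≗ v) (D-cong Δu≗ v))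
    ...     | inj₂ B-div = inj₂ B-div
    descent (suc i) (suc j) {A} {B} A-per B-per AB-per
        | inj₂ q∣ΣB with antidifference q m′ B-per q∣ΣB
    ...   | u , w , u-per , w-per , B≗
      with descent (suc i) j A-per u-per (corr-antidifferenceʳ q m′ {A = A} {u = u} u-per w-per B≗ AB-per)
    ...     | inj₁ A-div = inj₁ A-div
    ...     | inj₂ (u′ , u′-per , Δu≗) = inj₂
      (u′ , u′-per , λ v → trans (Δ-antidifference {A = B} {u = u} w-per B≗ v) (D-cong Δu≗ v))

    -- A difference of order `K * q ^ suc s` of a sequence with period q^(s+1) is divisible by q^K,
    -- which exceeds the bound `K` on the values of `Δ m′ f`; so these vanish.
    Δ-vanishes : ∀ {f u} K → Periodic (q * m′) u → (∀ v → ℤ.∣ Δ m′ f v ∣ ≤ K) →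
                 Δ m′ f ≗ D^ (K * q ^ suc s) u → Periodic m′ f
    Δ-vanishes {f} K u-per ≤K Δf≗ v = ℤ.i-j≡0⇒i≡j (f (v + m′)) (f v)
      (small∧∣⇒≡0 (ℕ.≤-<-trans (≤K v) (n<q^n K))
        (subst (+ (q ^ K) ℤ.∣_) (sym (Δf≗ v)) (q^M∣D^ (suc s) K u-per v)))

    -- The quotient by the m′-periodic sequences is ℤ[ζ] for a primitive q^(s+1)-th root of unity ζ,
    -- which has no zero divisors. The depths of the descent come from bounds on `Δ m′ A` and
    -- `Δ m′ B`, so that whichever proves to be a deep difference is zero.
    corr-domain : Periodic (q * m′) A → Periodic (q * m′) B →
                  Periodic m′ (corr (q * m′) A B) → Periodic m′ A ⊎ Periodic m′ B
    corr-domain {A} {B} A-per B-per AB-per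
      with bounded (q * m′) {{m^n≢0 q (suc s)}} (Δ-periodic m′ A-per)
         | bounded (q * m′) {{m^n≢0 q (suc s)}} (Δ-periodic m′ B-per)
    ... | K , A≤K | L , B≤L
      with descent (K * q ^ suc s) (L * q ^ suc s) A-per B-per AB-per
    ... | inj₁ (u , u-per , ΔA≗) = inj₁ (Δ-vanishes K u-per A≤K ΔA≗)
    ... | inj₂ (u , u-per , ΔB≗) = inj₂ (Δ-vanishes L u-per B≤L ΔB≗)

-- The inequality for a pair of correlated sequences

-- The last hypothesis encodes that the exponent of q in ΣB is at most s - t. Stated for all `r`, it
-- also rules out ΣB = 0 and passes to either fold without computing a valuation.
head-bound : ∀ {q} (q-prime : Prime q) s t {A B C} → Periodic (q ^ s) A → Periodic (q ^ s) B →
             (∀ v → corr (q ^ s) A B v ≡ C) →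
             (∀ i → 0 < i → i < q ^ s → 0ℤ ℤ.≤ A i) →
             (∀ r → + (q ^ r) ℤ.∣ Σ< (q ^ s) B → r + t ≤ s) →
             + (q ^ t) ℤ.* A 0 ℤ.≤ Σ< (q ^ s) A
head-bound {q} q-prime s zero {A} A-per B-per AB≡C 0≤A val =
  subst (ℤ._≤ Σ< (q ^ s) A) (sym (ℤ.*-identityˡ (A 0)))
    (head≤Σ (q ^ s) {{m^n≢0 q s {{prime⇒nonZero q-prime}}}} 0≤A)
-- As 1 divides ΣB, the hypothesis at r = 0 reads suc t ≤ 0.
head-bound q-prime zero (suc t) {A} {B} A-per B-per AB≡C 0≤A val =
  contradiction (val 0 (ℤ.divides (Σ< 1 B) (sym (ℤ.*-identityʳ _)))) λ ()
head-bound {q} q-prime (suc s) (suc t) {A} {B} {C} A-per B-per AB≡C 0≤A val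
  with corr-domain q-prime s {A} {B} A-per B-per (λ v → trans (AB≡C (v + q ^ s)) (sym (AB≡C v)))
-- `A` is folded, with `t` unchanged: the terms A (j m′) added to its head are nonnegative, and the
-- factor q lost by ΣB pays for the drop of s.
... | inj₂ B-per′ = begin
  + (q ^ suc t) ℤ.* A 0              ≤⟨ ℤ.*-monoˡ-≤-nonNeg (+ (q ^ suc t)) (head≤Σ q 0≤Aj) ⟩
  + (q ^ suc t) ℤ.* fold q m′ A 0
    ≤⟨ head-bound q-prime s (suc t) (fold-periodic q m′ A-per) B-per′ AB≡C′ 0≤fold val′ ⟩
  Σ< m′ (fold q m′ A)                  ≡⟨ Σ-fold q m′ A ⟩
  Σ< (q * m′) A                       ∎
  where
  open ℤ.≤-Reasoning
  m′ = q ^ s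
  instance
    _ = prime⇒nonZero q-prime
    _ = m^n≢0 q s
  below : ∀ i j → i < m′ → j < q → i + j * m′ < q * m′
  below i j i<m′ j<q = ℕ.<-≤-trans (ℕ.+-monoˡ-< (j * m′) i<m′) (ℕ.*-monoˡ-≤ m′ j<q)
  0≤Aj : ∀ j → 0 < j → j < q → 0ℤ ℤ.≤ A (j * m′)
  0≤Aj j@(suc _) 0<j j<q = 0≤A (j * m′) (ℕ.<-≤-trans (ℕ.m^n>0 q s) (ℕ.m≤m+n m′ _)) (below 0 j (ℕ.m^n>0 q s) j<q)
  0≤fold : ∀ i → 0 < i → i < m′ → 0ℤ ℤ.≤ fold q m′ A i
  0≤fold i 0<i i<m′ = Σ-nonneg q λ j j<q → 0≤A (i + j * m′) (ℕ.<-≤-trans 0<i (ℕ.m≤m+n i _)) (below i j i<m′ j<q)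
  AB≡C′ : ∀ v → corr m′ (fold q m′ A) B v ≡ C
  AB≡C′ v = trans (sym (corr-foldˡ q m′ A B-per′ v)) (AB≡C v)
  val′ : ∀ r → + (q ^ r) ℤ.∣ Σ< m′ B → r + suc t ≤ s
  val′ r q^r∣ = ℕ.≤-pred (val (suc r)
    (subst₂ ℤ._∣_ (sym (ℤ.pos-* q (q ^ r))) (sym (Σ-periodic q m′ B-per′)) (ℤ.*-monoʳ-∣ (+ q) q^r∣)))
-- `B` is folded, with its sum unchanged, and `t` drops along with s: the inequality for a single
-- period of `A`, multiplied by q, is the one for q periods.
... | inj₁ A-per′ = begin
  + (q ^ suc t) ℤ.* A 0              ≡⟨ cong (ℤ._* A 0) (ℤ.pos-* q (q ^ t)) ⟩
  + q ℤ.* + (q ^ t) ℤ.* A 0          ≡⟨ ℤ.*-assoc (+ q) (+ (q ^ t)) (A 0) ⟩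
  + q ℤ.* (+ (q ^ t) ℤ.* A 0)
    ≤⟨ ℤ.*-monoˡ-≤-nonNeg (+ q) (head-bound q-prime s t A-per′ (fold-periodic q m′ B-per) AB≡C′ 0≤A′ val′) ⟩
  + q ℤ.* Σ< m′ A                     ≡⟨ Σ-periodic q m′ A-per′ ⟨
  Σ< (q * m′) A                       ∎
  where
  open ℤ.≤-Reasoning
  m′ = q ^ s
  instance
    _ = prime⇒nonZero q-prime
  AB≡C′ : ∀ v → corr m′ A (fold q m′ B) v ≡ C
  AB≡C′ v = trans (sym (corr-foldʳ q m′ B A-per′ v)) (AB≡C v)
  0≤A′ : ∀ i → 0 < i → i < m′ → 0ℤ ℤ.≤ A i
  0≤A′ i 0<i i<m′ = 0≤A i 0<i (ℕ.<-≤-trans i<m′ (ℕ.m≤n*m m′ q))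
  val′ : ∀ r → + (q ^ r) ℤ.∣ Σ< m′ (fold q m′ B) → r + t ≤ s
  val′ r q^r∣ = ℕ.≤-pred (subst (_≤ suc s) (ℕ.+-suc r t)
    (val r (subst (+ (q ^ r) ℤ.∣_) (Σ-fold q m′ B) q^r∣)))

-- Circulant operators on periodic sequences

Σᵥ : ∀ {X : Set} {k} → (X → ℤ) → Vec X k → ℤ
Σᵥ h []       = 0ℤ
Σᵥ h (x ∷ xs) = h x ℤ.+ Σᵥ h xs

Σ-Σᵥ : ∀ n (h : ℕ → ℕ → ℤ) {k} (ls : Vec ℕ k) →
       Σ< n (λ i → Σᵥ (h i) ls) ≡ Σᵥ (λ l → Σ< n (λ i → h i l)) ls
Σ-Σᵥ n h []       = Σ-zero n
Σ-Σᵥ n h (l ∷ ls) = trans (Σ-+ n _ _) (cong (ℤ._+_ (Σ< n (λ i → h i l))) (Σ-Σᵥ n h ls))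

-- `sum ls` serves as a common bound for the distances, so that agreement within a finite window
-- suffices.
Σᵥ-cong-≤sum : ∀ {g h : ℕ → ℤ} {k} (ls : Vec ℕ k) → (∀ l → l ≤ sum ls → g l ≡ h l) → Σᵥ g ls ≡ Σᵥ h ls
Σᵥ-cong-≤sum []       g≗h = refl
Σᵥ-cong-≤sum (l ∷ ls) g≗h = cong₂ ℤ._+_ (g≗h l (ℕ.m≤m+n l _))
  (Σᵥ-cong-≤sum ls λ l′ l′≤ → g≗h l′ (ℕ.≤-trans l′≤ (ℕ.m≤n+m _ l)))

Σᵥ-cong : ∀ {g h : ℕ → ℤ} {k} (ls : Vec ℕ k) → g ≗ h → Σᵥ g ls ≡ Σᵥ h ls
Σᵥ-cong ls g≗h = Σᵥ-cong-≤sum ls λ l _ → g≗h l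

δ : ℕ → ℕ → ℤ
δ e i = if does (i ℕ.≟ e) then 1ℤ else 0ℤ

δ-≡ : ∀ e → δ e e ≡ 1ℤ
δ-≡ e = cong (if_then 1ℤ else 0ℤ) (dec-true (e ℕ.≟ e) refl)

δ-≢ : ∀ {e i} → i ≢ e → δ e i ≡ 0ℤ
δ-≢ {e} {i} i≢e = cong (if_then 1ℤ else 0ℤ) (dec-false (i ℕ.≟ e) i≢e)

0≤δ : ∀ e i → 0ℤ ℤ.≤ δ e i
0≤δ e i with does (i ℕ.≟ e)
... | true  = ℤ.+≤+ z≤n
... | false = ℤ.+≤+ z≤n

Σ-δ : ∀ n {e} (g : ℕ → ℤ) → e < n → Σ< n (λ i → δ e i ℤ.* g i) ≡ g e
Σ-δ (suc n) {e} g e<1+n with ℕ.m≤n⇒m<n∨m≡n (ℕ.≤-pred e<1+n)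
... | inj₁ e<n  = begin
  Σ< n (λ i → δ e i ℤ.* g i) ℤ.+ δ e n ℤ.* g n
    ≡⟨ cong₂ (λ x y → x ℤ.+ y ℤ.* g n) (Σ-δ n g e<n) (δ-≢ (ℕ.>⇒≢ e<n)) ⟩
  g e ℤ.+ 0ℤ                                      ≡⟨ ℤ.+-identityʳ (g e) ⟩
  g e                                             ∎
  where open ≡-Reasoning
... | inj₂ refl = begin
  Σ< n (λ i → δ n i ℤ.* g i) ℤ.+ δ n n ℤ.* g n
    ≡⟨ cong₂ (λ x y → x ℤ.+ y ℤ.* g n) vanish (δ-≡ n) ⟩
  0ℤ ℤ.+ 1ℤ ℤ.* g n                               ≡⟨ trans (ℤ.+-identityˡ _) (ℤ.*-identityˡ (g n)) ⟩
  g n                                             ∎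
  where
  open ≡-Reasoning
  vanish : Σ< n (λ i → δ n i ℤ.* g i) ≡ 0ℤ
  vanish = trans (Σ-cong n λ i i<n → cong (ℤ._* g i) (δ-≢ (ℕ.<⇒≢ i<n))) (Σ-zero n)

module _ (m : ℕ) .{{_ : NonZero m}} where

  χ : ℕ → ℕ → ℤ
  χ e r = δ (e % m) (r % m)

  χ-periodic : ∀ e → Periodic m (χ e)
  χ-periodic e r = cong (δ (e % m)) ([m+n]%n≡m%n r m)

  corr-χ : ∀ e → Periodic m B → ∀ v → corr m (χ e) B v ≡ B (v + e)
  corr-χ {B} e B-per v = begin
    Σ< m (λ i → χ e i ℤ.* B (v + i))
      ≡⟨ Σ-cong m (λ i i<m → cong (λ x → δ (e % m) x ℤ.* B (v + i)) (m<n⇒m%n≡m i<m)) ⟩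
    Σ< m (λ i → δ (e % m) i ℤ.* B (v + i))    ≡⟨ Σ-δ m (λ i → B (v + i)) (m%n<n e m) ⟩
    B (v + e % m)
      ≡⟨ periodic-% m (λ i → trans (cong B (sym (ℕ.+-assoc v i m))) (B-per (v + i))) e ⟩
    B (v + e)                                 ∎
    where open ≡-Reasoning

  -- The symbol of the operator B ↦ θ B(v) + Σ (B(v + l) + B(v − l)) on ℤ/m;
  -- the caller supplies a p that represents −1 modulo m.
  symbol : ∀ {k} → ℤ → ℕ → Vec ℕ k → ℕ → ℤ
  symbol θ p []       r = θ ℤ.* χ 0 r
  symbol θ p (l ∷ ls) r = χ l r ℤ.+ χ (l * p) r ℤ.+ symbol θ p ls r

  symbol-periodic : ∀ {k} θ p (ls : Vec ℕ k) → Periodic m (symbol θ p ls)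
  symbol-periodic θ p []       r = cong (θ ℤ.*_) (χ-periodic 0 r)
  symbol-periodic θ p (l ∷ ls) r =
    cong₂ ℤ._+_ (cong₂ ℤ._+_ (χ-periodic l r) (χ-periodic (l * p) r)) (symbol-periodic θ p ls r)

  corr-symbol : ∀ {k} θ p (ls : Vec ℕ k) → Periodic m B → ∀ v →
                corr m (symbol θ p ls) B v ≡ θ ℤ.* B v ℤ.+ Σᵥ (λ l → B (v + l) ℤ.+ B (v + l * p)) ls
  corr-symbol {B} θ p [] B-per v = begin
    Σ< m (λ i → θ ℤ.* χ 0 i ℤ.* B (v + i))
      ≡⟨ Σ-cong-≗ m (λ i → ℤ.*-assoc θ (χ 0 i) (B (v + i))) ⟩
    Σ< m (λ i → θ ℤ.* (χ 0 i ℤ.* B (v + i)))    ≡⟨ Σ-*ˡ m θ _ ⟩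
    θ ℤ.* corr m (χ 0) B v
      ≡⟨ cong (θ ℤ.*_) (trans (corr-χ 0 B-per v) (cong B (ℕ.+-identityʳ v))) ⟩
    θ ℤ.* B v                                   ≡⟨ ℤ.+-identityʳ _ ⟨
    θ ℤ.* B v ℤ.+ 0ℤ                            ∎
    where open ≡-Reasoning
  corr-symbol {B} θ p (l ∷ ls) B-per v = begin
    corr m (symbol θ p (l ∷ ls)) B v
      ≡⟨ corr-+ˡ m (λ r → χ l r ℤ.+ χ (l * p) r) (symbol θ p ls) B v ⟩
    corr m (λ r → χ l r ℤ.+ χ (l * p) r) B v ℤ.+ corr m (symbol θ p ls) B v
      ≡⟨ cong₂ ℤ._+_ (trans (corr-+ˡ m (χ l) (χ (l * p)) B v) (cong₂ ℤ._+_ (corr-χ l B-per v) (corr-χ (l * p) B-per v)))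
                     (corr-symbol θ p ls B-per v) ⟩
    B (v + l) ℤ.+ B (v + l * p) ℤ.+ (θ ℤ.* B v ℤ.+ Σᵥ (λ l → B (v + l) ℤ.+ B (v + l * p)) ls)
      ≡⟨ ℤ+.x∙yz≈y∙xz (B (v + l) ℤ.+ B (v + l * p)) (θ ℤ.* B v) _ ⟩
    θ ℤ.* B v ℤ.+ Σᵥ (λ l → B (v + l) ℤ.+ B (v + l * p)) (l ∷ ls)
      ∎
    where
    open ≡-Reasoning

  Σᵥ-χ-nonneg : ∀ {k} p (ls : Vec ℕ k) r → 0ℤ ℤ.≤ Σᵥ (λ l → χ l r ℤ.+ χ (l * p) r) ls
  Σᵥ-χ-nonneg p []       r = ℤ.≤-refl
  Σᵥ-χ-nonneg p (l ∷ ls) r =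
    ℤ.+-mono-≤ (ℤ.+-mono-≤ (0≤δ (l % m) (r % m)) (0≤δ (l * p % m) (r % m))) (Σᵥ-χ-nonneg p ls r)

  symbol≡ : ∀ {k} θ p (ls : Vec ℕ k) r → symbol θ p ls r ≡ θ ℤ.* χ 0 r ℤ.+ Σᵥ (λ l → χ l r ℤ.+ χ (l * p) r) ls
  symbol≡ θ p []       r = sym (ℤ.+-identityʳ _)
  symbol≡ θ p (l ∷ ls) r rewrite symbol≡ θ p ls r =
    ℤ+.x∙yz≈y∙xz (χ l r ℤ.+ χ (l * p) r) (θ ℤ.* χ 0 r) (Σᵥ (λ l → χ l r ℤ.+ χ (l * p) r) ls)

  -- Only an inequality: a distance divisible by `m` contributes at 0 as well.
  θ≤symbol[0] : ∀ {k} θ p (ls : Vec ℕ k) → θ ℤ.≤ symbol θ p ls 0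
  θ≤symbol[0] θ p ls = begin
    θ                                                              ≡⟨ unit θ ⟩
    θ ℤ.* 1ℤ ℤ.+ 0ℤ
      ≡⟨ cong (λ x → θ ℤ.* x ℤ.+ 0ℤ) (δ-≡ (0 % m)) ⟨
    θ ℤ.* χ 0 0 ℤ.+ 0ℤ
      ≤⟨ ℤ.+-monoʳ-≤ (θ ℤ.* χ 0 0) (Σᵥ-χ-nonneg p ls 0) ⟩
    θ ℤ.* χ 0 0 ℤ.+ Σᵥ (λ l → χ l 0 ℤ.+ χ (l * p) 0) ls            ≡⟨ symbol≡ θ p ls 0 ⟨
    symbol θ p ls 0                                                ∎
    where
    open ℤ.≤-Reasoning
    unit : ∀ x → x ≡ x ℤ.* 1ℤ ℤ.+ 0ℤ
    unit = ℤSolver.solve-∀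

  0≤symbol : ∀ {k} θ p (ls : Vec ℕ k) r → 0 < r → r < m → 0ℤ ℤ.≤ symbol θ p ls r
  0≤symbol θ p ls r 0<r r<m = begin
    0ℤ                                                             ≤⟨ Σᵥ-χ-nonneg p ls r ⟩
    S                                                              ≡⟨ zero-term θ S ⟩
    θ ℤ.* 0ℤ ℤ.+ S
      ≡⟨ cong (λ x → θ ℤ.* x ℤ.+ S) (δ-≢ r%m≢0%m) ⟨
    θ ℤ.* χ 0 r ℤ.+ S                                              ≡⟨ symbol≡ θ p ls r ⟨
    symbol θ p ls r                                                ∎
    where
    open ℤ.≤-Reasoning
    S = Σᵥ (λ l → χ l r ℤ.+ χ (l * p) r) ls
    zero-term : ∀ x y → y ≡ x ℤ.* 0ℤ ℤ.+ y
    zero-term = ℤSolver.solve-∀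
    r%m≢0%m : r % m ≢ 0 % m
    r%m≢0%m eq = ℕ.>⇒≢ 0<r (trans (sym (m<n⇒m%n≡m r<m)) (trans eq (m<n⇒m%n≡m (ℕ.<-trans 0<r r<m))))

  -- Correlation with the constant 1 evaluates the operator on that sequence, where each distance
  -- contributes 2.
  Σ-symbol : ∀ {k} θ p (ls : Vec ℕ k) → Σ< m (symbol θ p ls) ≡ θ ℤ.+ + (k + k)
  Σ-symbol {k} θ p ls = begin
    Σ< m (symbol θ p ls)
      ≡⟨ Σ-cong-≗ m (λ i → ℤ.*-identityʳ (symbol θ p ls i)) ⟨
    corr m (symbol θ p ls) (λ _ → 1ℤ) 0                    ≡⟨ corr-symbol θ p ls (λ _ → refl) 0 ⟩
    θ ℤ.* 1ℤ ℤ.+ Σᵥ (λ _ → + 2) ls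
      ≡⟨ cong₂ ℤ._+_ (ℤ.*-identityʳ θ) (twos ls) ⟩
    θ ℤ.+ + (k + k)                                        ∎
    where
    open ≡-Reasoning
    twos : ∀ {k} (ls : Vec ℕ k) → Σᵥ (λ _ → + 2) ls ≡ + (k + k)
    twos []                 = refl
    twos {suc k} (l ∷ ls) rewrite twos ls | ℕ.+-suc k k = refl

-- Valuations at q and the bound for periodic solutions.

^-∣-injective : ∀ {q} → 1 < q → ∀ {i j} → q ^ i ∣ q ^ j → i ≤ j
^-∣-injective {q@(suc _)} 1<q {i} {j} q^i∣q^j = ℕ.≮⇒≥ λ j<i →
  ℕ.<⇒≱ (ℕ.^-monoʳ-< q 1<q j<i) (ℕ.∣⇒≤ {{m^n≢0 q j}} q^i∣q^j)

extract-power : ∀ {q} → Prime q → ∀ T .{{_ : NonZero T}} → ∃[ s ] ∃[ T′ ] T ≡ T′ * q ^ s × ¬ q ∣ T′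
extract-power {q} q-prime T = go T (<-wellFounded T)
  where
  instance
    _ = prime⇒nonTrivial q-prime
  go : ∀ T .{{_ : NonZero T}} → Acc _<_ T → ∃[ s ] ∃[ T′ ] T ≡ T′ * q ^ s × ¬ q ∣ T′
  go T (acc rec) with q ℕ.∣? T
  ... | no  q∤T = 0 , T , sym (ℕ.*-identityʳ T) , q∤T
  ... | yes q∣T with go (ℕ.quotient q∣T) {{ℕ.quotient≢0 q∣T}} (rec (ℕ.quotient-< q∣T))
  ...   | s , T′ , eq , q∤T′ = suc s , T′ , eq′ , q∤T′
    where
    eq′ : T ≡ T′ * q ^ suc s
    eq′ = trans (ℕ.m∣n⇒n≡quotient*m q∣T) (trans (cong (_* q) eq) (reorder T′ (q ^ s) q))
      where
      reorder : ∀ a b c → a * b * c ≡ a * (c * b)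
      reorder = ℕSolver.solve-∀

module _ {q b c t : ℕ} (q-prime : Prime q) .{{_ : NonZero t}} .{{_ : NonZero (gcd b c)}}
         (q^t∣n/g : q ^ t ∣ (b + c) / gcd b c) where

  private
    g′ = gcd b c
    g∣c : g′ ∣ c
    g∣c = gcd[m,n]∣n b c
    g∣b+c : g′ ∣ b + c
    g∣b+c = ℕ.∣m∣n⇒∣m+n (gcd[m,n]∣m b c) g∣c

  q^t∣b+c : q ^ t ∣ b + c
  q^t∣b+c = ℕ.∣-trans q^t∣n/g (ℕ.m/n∣m g∣b+c)

  -- (b + c)/gcd and c/gcd are coprime: with a common factor q, the product q · gcd would divide
  -- both `b` and `c`, hence their gcd.
  q∤c/gcd : ¬ q ∣ c / g′
  q∤c/gcd q∣c/g = ℕ.<⇒≢ (1<q q-prime) (sym (ℕ.∣1⇒≡1 (ℕ.*-cancelʳ-∣ g′ qg∣g)))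
    where
    -- The positivity of `t` enters here.
    q∣q^t : ∀ t .{{_ : NonZero t}} → q ∣ q ^ t
    q∣q^t (suc t) = ℕ.m∣m*n (q ^ t)
    qg∣c : q * g′ ∣ c
    qg∣c = ℕ.m∣n/o⇒m*o∣n g∣c q∣c/g
    qg∣b : q * g′ ∣ b
    qg∣b = ℕ.∣m+n∣m⇒∣n (subst (q * g′ ∣_) (ℕ.+-comm b c) (ℕ.m∣n/o⇒m*o∣n g∣b+c (ℕ.∣-trans (q∣q^t t) q^t∣n/g))) qg∣c
    qg∣g : q * g′ ∣ 1 * g′
    qg∣g = subst (q * g′ ∣_) (sym (ℕ.*-identityˡ g′)) (gcd-greatest qg∣b qg∣c)

  -- Divided by gcd(b, c), the equation reads X · (b + c)/gcd = q^s · T′ · c/gcd. The left side is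
  -- divisible by q^(r+t), and on the right q divides neither `T′` nor c/gcd.
  valuation-bound : ∀ s T′ X → ¬ q ∣ T′ → (b + c) * X ≡ q ^ s * T′ * c → ∀ r → q ^ r ∣ X → r + t ≤ s
  valuation-bound s T′ X q∤T′ nX≡Tc r q^r∣X = ^-∣-injective (1<q q-prime)
    (prime-power-cancelʳ q-prime (r + t) (q ^ s) T′ q∤T′
      (prime-power-cancelʳ q-prime (r + t) (q ^ s * T′) (c / g′) q∤c/gcd
        (subst₂ _∣_ (sym (ℕ.^-distribˡ-+-* q r t)) reduced (ℕ.*-pres-∣ q^r∣X q^t∣n/g))))
    where
    open ≡-Reasoning
    reorder : ∀ a b c → a * b * c ≡ b * c * a
    reorder = ℕSolver.solve-∀
    reduced : X * ((b + c) / g′) ≡ q ^ s * T′ * (c / g′)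
    reduced = ℕ.*-cancelʳ-≡ _ _ g′ (begin
      X * ((b + c) / g′) * g′          ≡⟨ reorder X ((b + c) / g′) g′ ⟩
      (b + c) / g′ * g′ * X            ≡⟨ cong (_* X) (m/n*n≡m g∣b+c) ⟩
      (b + c) * X                      ≡⟨ nX≡Tc ⟩
      q ^ s * T′ * c                   ≡⟨ cong (q ^ s * T′ *_) (m/n*n≡m g∣c) ⟨
      q ^ s * T′ * (c / g′ * g′)       ≡⟨ ℕ.*-assoc (q ^ s * T′) (c / g′) g′ ⟨
      q ^ s * T′ * (c / g′) * g′       ∎)

  -- Folding removes the part `T′` of the period prime to q. The symbol is taken modulo q^s
  -- accordingly; its sum is still θ + 2k = b + c, and its head is at least θ.
  periodic-solution-bound : ∀ {k} (ls : Vec ℕ k) T p {F} .{{_ : NonZero T}} → Periodic T F →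
    (let θ = + (b + c) ℤ.- + (k + k) in
     (∀ w → θ ℤ.* F w ℤ.+ Σᵥ (λ l → F (w + l) ℤ.+ F (w + l * p)) ls ≡ + c) →
     + (q ^ t) ℤ.* θ ℤ.≤ + (b + c))
  periodic-solution-bound {k} ls T p {F} F-per F-eq with extract-power q-prime T
  ... | s , T′ , refl , q∤T′ = begin
    + (q ^ t) ℤ.* θ     ≤⟨ ℤ.*-monoˡ-≤-nonNeg (+ (q ^ t)) (θ≤symbol[0] m′ θ p ls) ⟩
    + (q ^ t) ℤ.* P 0
      ≤⟨ head-bound q-prime s t (symbol-periodic m′ θ p ls) B-per PB≡ (0≤symbol m′ θ p ls) val ⟩
    Σ< m′ P             ≡⟨ ΣP≡ ⟩
    + (b + c)           ∎
    where
    open ℤ.≤-Reasoning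
    m′ = q ^ s
    θ = + (b + c) ℤ.- + (k + k)
    instance
      _ = m^n≢0 q s {{prime⇒nonZero q-prime}}
    P = symbol m′ θ p ls
    F̄ = fold T′ m′ F
    B-per : Periodic m′ F̄
    B-per = fold-periodic T′ m′ F-per
    ΣP≡ : Σ< m′ P ≡ + (b + c)
    ΣP≡ = trans (Σ-symbol m′ θ p ls) (cancel (+ (b + c)) (+ (k + k)))
      where
      cancel : ∀ x y → x ℤ.- y ℤ.+ y ≡ x
      cancel = ℤSolver.solve-∀
    fold-shift : ∀ v e → F̄ (v + e) ≡ Σ< T′ (λ j → F (v + j * m′ + e))
    fold-shift v e = Σ-cong-≗ T′ λ j → cong F (ℕ+.xy∙z≈xz∙y v e (j * m′))
    -- The equations at the `T′` points of a fibre add up, each contributing `c`.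
    PB≡ : ∀ v → corr m′ P F̄ v ≡ + T′ ℤ.* + c
    PB≡ v = begin-equality
      corr m′ P F̄ v
        ≡⟨ corr-symbol m′ θ p ls B-per v ⟩
      θ ℤ.* F̄ v ℤ.+ Σᵥ (λ l → F̄ (v + l) ℤ.+ F̄ (v + l * p)) ls
        ≡⟨ cong₂ ℤ._+_ (sym (Σ-*ˡ T′ θ _)) (Σᵥ-cong ls λ l →
             trans (cong₂ ℤ._+_ (fold-shift v l) (fold-shift v (l * p))) (sym (Σ-+ T′ _ _))) ⟩
      Σ< T′ (λ j → θ ℤ.* F (v + j * m′)) ℤ.+
      Σᵥ (λ l → Σ< T′ (λ j → F (v + j * m′ + l) ℤ.+ F (v + j * m′ + l * p))) ls
        ≡⟨ cong (ℤ._+_ (Σ< T′ (λ j → θ ℤ.* F (v + j * m′)))) (Σ-Σᵥ T′ _ ls) ⟨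
      Σ< T′ (λ j → θ ℤ.* F (v + j * m′)) ℤ.+
      Σ< T′ (λ j → Σᵥ (λ l → F (v + j * m′ + l) ℤ.+ F (v + j * m′ + l * p)) ls)
        ≡⟨ Σ-+ T′ _ _ ⟨
      Σ< T′ (λ j → θ ℤ.* F (v + j * m′) ℤ.+ Σᵥ (λ l → F (v + j * m′ + l) ℤ.+ F (v + j * m′ + l * p)) ls)
        ≡⟨ Σ-cong-≗ T′ (λ j → F-eq (v + j * m′)) ⟩
      Σ< T′ (λ _ → + c)
        ≡⟨ Σ-const T′ (+ c) ⟩
      + T′ ℤ.* + c ∎
    nX≡Tc : + (b + c) ℤ.* Σ< m′ F̄ ≡ + (m′ * T′ * c)
    nX≡Tc = begin-equality
      + (b + c) ℤ.* Σ< m′ F̄              ≡⟨ cong (ℤ._* Σ< m′ F̄) ΣP≡ ⟨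
      Σ< m′ P ℤ.* Σ< m′ F̄                ≡⟨ Σ-corr m′ P B-per ⟨
      Σ< m′ (corr m′ P F̄)                ≡⟨ Σ-cong-≗ m′ PB≡ ⟩
      Σ< m′ (λ _ → + T′ ℤ.* + c)          ≡⟨ Σ-const m′ _ ⟩
      + m′ ℤ.* (+ T′ ℤ.* + c)             ≡⟨ ℤ.*-assoc (+ m′) (+ T′) (+ c) ⟨
      + m′ ℤ.* + T′ ℤ.* + c               ≡⟨ cong (ℤ._* + c) (ℤ.pos-* m′ T′) ⟨
      + (m′ * T′) ℤ.* + c                 ≡⟨ ℤ.pos-* (m′ * T′) c ⟨
      + (m′ * T′ * c)                     ∎
    val : ∀ r → + (q ^ r) ℤ.∣ Σ< m′ F̄ → r + t ≤ s
    val r q^r∣X = valuation-bound s T′ ℤ.∣ Σ< m′ F̄ ∣ q∤T′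
      (trans (sym (ℤ.abs-* (+ (b + c)) (Σ< m′ F̄))) (cong ℤ.∣_∣ nX≡Tc)) r (ℤ.∣⇒∣ᵤ q^r∣X)

-- From solutions with finitely many values to periodic ones

window : ∀ {r} → (ℕ → Fin r) → (N : ℕ) → ℕ → Fin N → Fin r
window h N j x = h (j + toℕ x)

-- There are r^N windows of length `N`, so two of the first r^N + 1 coincide; `funToFin` numbers
-- them for the pigeonhole principle. `T` is the distance between their starts, and they may
-- overlap.
repeated-window : ∀ {r} (h : ℕ → Fin r) N →
                  ∃[ i ] ∃[ T ] 0 < T × (∀ x → x < N → h (i + T + x) ≡ h (i + x))
repeated-window {r} h N
  with Fin.pigeonhole {n = suc (r ^ N)} ℕ.≤-refl (λ j → funToFin (window h N (toℕ j)))
... | i , j , i<j , codeᵢ≡codeⱼ = toℕ i , toℕ j ∸ toℕ i , ℕ.m<n⇒0<n∸m i<j , same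
  where
  open ≡-Reasoning
  same-Fin : ∀ x → h (toℕ j + toℕ x) ≡ h (toℕ i + toℕ x)
  same-Fin x = begin
    window h N (toℕ j) x                           ≡⟨ Fin.finToFun-funToFin (window h N (toℕ j)) x ⟨
    finToFun (funToFin (window h N (toℕ j))) x     ≡⟨ cong (λ y → finToFun y x) codeᵢ≡codeⱼ ⟨
    finToFun (funToFin (window h N (toℕ i))) x     ≡⟨ Fin.finToFun-funToFin (window h N (toℕ i)) x ⟩
    window h N (toℕ i) x                           ∎
  same : ∀ x → x < N → h (toℕ i + (toℕ j ∸ toℕ i) + x) ≡ h (toℕ i + x)
  same x x<N rewrite ℕ.m+[n∸m]≡n (ℕ.<⇒≤ i<j) =
    subst (λ y → h (toℕ j + y) ≡ h (toℕ i + y)) (Fin.toℕ-fromℕ< x<N) (same-Fin (fromℕ< x<N))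

-- Repeated subtraction of `T`: each step starts below T + N, hence lands below `N`, where the
-- hypothesis applies.
window-% : ∀ {X : Set} (g : ℕ → X) T .{{_ : NonZero T}} N →
           (∀ x → x < N → g (T + x) ≡ g x) → ∀ x → x < T + N → g (x % T) ≡ g x
window-% g T N g-per x = go x (<-wellFounded x)
  where
  open ≡-Reasoning
  go : ∀ x → Acc _<_ x → x < T + N → g (x % T) ≡ g x
  go x (acc rec) x<T+N with x ℕ.<? T
  ... | yes x<T = cong g (m<n⇒m%n≡m x<T)
  ... | no  x≮T = begin
    g (x % T)           ≡⟨ cong g (m≤n⇒[n∸m]%m≡n%m T≤x) ⟨
    g (y % T)           ≡⟨ go y (rec y<x) (ℕ.<-trans y<x x<T+N) ⟩
    g y                 ≡⟨ g-per y y<N ⟨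
    g (T + y)           ≡⟨ cong g (ℕ.m+[n∸m]≡n T≤x) ⟩
    g x                 ∎
    where
    y = x ∸ T
    T≤x = ℕ.≮⇒≥ x≮T
    y<x : y < x
    y<x = ℕ.∸-monoʳ-< {x} {T} {0} (ℕ.n≢0⇒n>0 (≢-nonZero⁻¹ T)) T≤x
    y<N : y < N
    y<N = ℕ.+-cancelˡ-< T y N (subst (_< T + N) (sym (ℕ.m+[n∸m]≡n T≤x)) x<T+N)

-- A solution with finitely many values need not be periodic a priori, but
-- repeating the stretch of it between two equal, long enough windows is again
-- a solution.
periodic-solution : ∀ {k r C} θ (ls : Vec ℕ k) (f : ℤ → Fin r) (wt : Fin r → ℤ) →
  (∀ v → θ ℤ.* wt (f v) ℤ.+ Σᵥ (λ l → wt (f (v ℤ.+ + l)) ℤ.+ wt (f (v ℤ.- + l))) ls ≡ C) →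
  ∃[ p ] ∃[ F ] Periodic (suc p) F ×
    (∀ w → θ ℤ.* F w ℤ.+ Σᵥ (λ l → F (w + l) ℤ.+ F (w + l * p)) ls ≡ C)
periodic-solution {k} {r} {C} θ ls f wt f-eq
  -- The equation at a vertex reaches at most `sum ls` to either side, hence windows of twice that
  -- length.
  with repeated-window (λ x → f (+ x)) (sum ls + sum ls)
... | i , T@(suc p) , _ , same = p , F , F-per , equation
  where
  open ≡-Reasoning
  L = sum ls
  h : ℕ → Fin r
  h x = f (+ (i + x))
  h-% : ∀ x → x < T + (L + L) → h (x % T) ≡ h x
  h-% = window-% h T (L + L) λ x x<N → trans (cong (f ∘ +_) (sym (ℕ.+-assoc i T x))) (same x x<N)
  F : ℕ → ℤ
  F v = wt (h (v % T))
  F-per : Periodic T F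
  F-per v = cong (wt ∘ h) ([m+n]%n≡m%n v T)
  E : ℕ → ℤ
  E w = θ ℤ.* F w ℤ.+ Σᵥ (λ l → F (w + l) ℤ.+ F (w + l * p)) ls
  E-per : Periodic T E
  E-per w = cong₂ (λ x y → θ ℤ.* x ℤ.+ y) (F-per w) (Σᵥ-cong ls λ l →
    cong₂ ℤ._+_ (shift l) (shift (l * p)))
    where
    shift : ∀ e → F (w + T + e) ≡ F (w + e)
    shift e = trans (cong F (ℕ+.xy∙z≈xz∙y w T e)) (F-per (w + e))
  -- One full period of positions, offset by `L` so that left neighbours do not precede the window
  -- and right ones remain below T + 2 L.
  E-at : ∀ y → y < T → E (L + y) ≡ C
  E-at y y<T = begin
    E w
      ≡⟨ cong₂ (λ x y → θ ℤ.* x ℤ.+ y) F≡ (Σᵥ-cong-≤sum ls neighbours) ⟩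
    θ ℤ.* wt (f v) ℤ.+ Σᵥ (λ l → wt (f (v ℤ.+ + l)) ℤ.+ wt (f (v ℤ.- + l))) ls
      ≡⟨ f-eq v ⟩
    C ∎
    where
    w = L + y
    v = + (i + w)
    in-range : ∀ x → x ≤ w + L → x < T + (L + L)
    in-range x x≤ = ℕ.≤-<-trans x≤ (subst₂ _<_ (reorder y L L) refl (ℕ.+-monoˡ-< (L + L) y<T))
      where
      reorder : ∀ y a b → y + (a + b) ≡ a + y + b
      reorder = ℕSolver.solve-∀
    F≡ : F w ≡ wt (f v)
    F≡ = cong wt (h-% w (in-range w (ℕ.m≤m+n w L)))
    neighbours : ∀ l → l ≤ L →
                 F (w + l) ℤ.+ F (w + l * p) ≡ wt (f (v ℤ.+ + l)) ℤ.+ wt (f (v ℤ.- + l))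
    neighbours l l≤L = cong₂ ℤ._+_ right left
      where
      w₀ = w ∸ l
      w≡ : w₀ + l ≡ w
      w≡ = ℕ.m∸n+n≡m (ℕ.≤-trans l≤L (ℕ.m≤m+n L y))
      right : F (w + l) ≡ wt (f (v ℤ.+ + l))
      right = cong wt (trans (h-% (w + l) (in-range _ (ℕ.+-monoʳ-≤ w l≤L))) (cong (f ∘ +_) (sym (ℕ.+-assoc i w l))))
      -- As T = p + 1, moving right by l * p is moving left by `l`, up to `l` periods.
      left : F (w + l * p) ≡ wt (f (v ℤ.- + l))
      left = begin
        F (w + l * p)                       ≡⟨ cong (λ x → F (x + l * p)) w≡ ⟨
        F (w₀ + l + l * p)                  ≡⟨ cong F (reorder w₀ l p) ⟩
        F (w₀ + l * T)                      ≡⟨ periodic-* {T} {F} l F-per w₀ ⟩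
        F w₀
          ≡⟨ cong wt (h-% w₀ (in-range w₀ (ℕ.≤-trans (ℕ.m∸n≤m w l) (ℕ.m≤m+n w L)))) ⟩
        wt (f (+ (i + w₀)))          ≡⟨ cong (wt ∘ f) (cancel (+ i) (+ w₀) (+ l)) ⟩
        wt (f (+ (i + (w₀ + l)) ℤ.- + l)) ≡⟨ cong (λ x → wt (f (+ (i + x) ℤ.- + l))) w≡ ⟩
        wt (f (v ℤ.- + l))           ∎
        where
        reorder : ∀ w l p → w + l + l * p ≡ w + l * suc p
        reorder = ℕSolver.solve-∀
        cancel : ∀ x y z → x ℤ.+ y ≡ x ℤ.+ (y ℤ.+ z) ℤ.- z
        cancel = ℤSolver.solve-∀
  equation : ∀ w → E w ≡ C
  -- Moving `w` by `L` periods makes it at least `L`; what exceeds `L` is then reduced modulo `T`.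
  equation w = begin
    E w                              ≡⟨ periodic-* {T} {E} L E-per w ⟨
    E (w + L * T)                    ≡⟨ cong E (reorder w L p) ⟩
    E (L + (w + L * p))
      ≡⟨ periodic-% {λ y → E (L + y)} T
           (λ y → trans (cong E (sym (ℕ.+-assoc L y T))) (E-per (L + y))) (w + L * p) ⟨
    E (L + (w + L * p) % T)          ≡⟨ E-at ((w + L * p) % T) (m%n<n (w + L * p) T) ⟩
    C                              ∎
    where
    reorder : ∀ w l p → w + l * suc p ≡ l + (w + l * p)
    reorder = ℕSolver.solve-∀

-- Finiteness of the set of values is what yields equal windows, so a colouring enters only through
-- its equation.
finite-valued-solution-bound : ∀ {k b c q t r}
  .{{_ : NonZero t}} .{{gcd≢0 : NonZero (gcd b c)}} .{{q^t≢0 : NonZero (q ^ t)}} →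
  Prime q → q ^ t ∣ (b + c) / gcd b c →
  (ls : Vec ℕ k) (f : ℤ → Fin r) (wt : Fin r → ℤ) →
  (∀ v → (+ (b + c) ℤ.- + (k + k)) ℤ.* wt (f v) ℤ.+
         Σᵥ (λ l → wt (f (v ℤ.+ + l)) ℤ.+ wt (f (v ℤ.- + l))) ls ≡ + c) →
  b + c ≤ 2 * k + (b + c) / q ^ t
finite-valued-solution-bound {k} {b} {c} {q} {t} q-prime q^t∣ ls f wt f-eq
  with periodic-solution (+ (b + c) ℤ.- + (k + k)) ls f wt f-eq
... | p , F , F-per , F-eq = ℤ.drop‿+≤+ (begin
  + N                                        ≡⟨ cancel (+ N) (+ (k + k)) ⟩
  + (k + k) ℤ.+ (+ N ℤ.- + (k + k))          ≤⟨ ℤ.+-monoʳ-≤ (+ (k + k)) θ≤ ⟩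
  + (k + k) ℤ.+ + (N / q ^ t)
    ≡⟨ cong (λ x → + (k + x + N / q ^ t)) (ℕ.+-identityʳ k) ⟨
  + (2 * k + N / q ^ t)                      ∎)
  where
  open ℤ.≤-Reasoning
  N = b + c
  cancel : ∀ x y → x ≡ y ℤ.+ (x ℤ.- y)
  cancel = ℤSolver.solve-∀
  θ≤ : + N ℤ.- + (k + k) ℤ.≤ + (N / q ^ t)
  θ≤ = ℤ.*-cancelˡ-≤-pos _ _ (+ (q ^ t)) {{ℤ.positive (ℤ.+<+ (ℕ.n≢0⇒n>0 (≢-nonZero⁻¹ (q ^ t))))}} (begin
    + (q ^ t) ℤ.* (+ N ℤ.- + (k + k))
      ≤⟨ periodic-solution-bound {b = b} {c} q-prime q^t∣ ls (suc p) p F-per F-eq ⟩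
    + N                                 ≡⟨ cong +_ (m*[n/m]≡n (q^t∣b+c {b = b} {c} q-prime q^t∣)) ⟨
    + (q ^ t * (N / q ^ t))             ≡⟨ ℤ.pos-* (q ^ t) (N / q ^ t) ⟩
    + (q ^ t) ℤ.* + (N / q ^ t)         ∎)

-- Imported only here: with the instance gcd-nonZero in scope, the instance
-- searches above do not terminate.
open import Defs

-- From perfect colourings to the linear equation.

enc : Colour → Fin 2
enc black = Fin.zero
enc white = Fin.suc Fin.zero

-- Composed with `enc` this is the indicator of black, so a sum of weights counts black neighbours;
-- the detour through `Fin 2` serves the pigeonhole argument.
weight : Fin 2 → ℤ
weight Fin.zero    = 1ℤ
weight (Fin.suc _) = 0ℤ

module _ {V : Set} (f : V → Colour) where

  count-black : ∀ {k} (vs : Vec V k) → + count (λ u → f u ≟ᶜ black) vs ≡ Σᵥ (weight ∘ enc ∘ f) vs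
  count-black []       = refl
  count-black (v ∷ vs) with f v
  ... | black = cong (ℤ._+_ 1ℤ) (count-black vs)
  ... | white = trans (count-black vs) (sym (ℤ.+-identityˡ _))

  count-white : ∀ {k} (vs : Vec V k) → + count (λ u → f u ≟ᶜ white) vs ≡ + k ℤ.- Σᵥ (weight ∘ enc ∘ f) vs
  count-white []       = refl
  count-white {suc k} (v ∷ vs) with f v
  ... | black = trans (count-white vs) (lemma (+ k) (Σᵥ (weight ∘ enc ∘ f) vs))
    where
    lemma : ∀ x y → x ℤ.- y ≡ 1ℤ ℤ.+ x ℤ.- (1ℤ ℤ.+ y)
    lemma = ℤSolver.solve-∀
  ... | white = trans (cong (ℤ._+_ 1ℤ) (count-white vs)) (lemma (+ k) (Σᵥ (weight ∘ enc ∘ f) vs))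
    where
    lemma : ∀ x y → 1ℤ ℤ.+ (x ℤ.- y) ≡ 1ℤ ℤ.+ x ℤ.- (0ℤ ℤ.+ y)
    lemma = ℤSolver.solve-∀

  -- A black vertex has d - b black neighbours and a white one has c; the coefficient b + c - d,
  -- felt at black vertices only, makes up the difference.
  perfect-equation : ∀ {d b c} (N : Neighbourhoods V d) → IsPerfect2Colouring N f b c → ∀ v →
    (+ (b + c) ℤ.- + d) ℤ.* weight (enc (f v)) ℤ.+ Σᵥ (weight ∘ enc ∘ f) (N v) ≡ + c
  perfect-equation {d} {b} {c} N (at-black , at-white) v = go (f v) refl
    where
    open ≡-Reasoning
    S = Σᵥ (weight ∘ enc ∘ f) (N v)
    go : ∀ x → f v ≡ x → (+ (b + c) ℤ.- + d) ℤ.* weight (enc x) ℤ.+ S ≡ + c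
    go black fv≡black = begin
      (+ b ℤ.+ + c ℤ.- + d) ℤ.* 1ℤ ℤ.+ S
        ≡⟨ cong (λ x → (x ℤ.+ + c ℤ.- + d) ℤ.* 1ℤ ℤ.+ S) b≡ ⟩
      (+ d ℤ.- S ℤ.+ + c ℤ.- + d) ℤ.* 1ℤ ℤ.+ S       ≡⟨ lemma (+ d) S (+ c) ⟩
      + c                                            ∎
      where
      b≡ : + b ≡ + d ℤ.- S
      b≡ = trans (cong +_ (sym (at-black v fv≡black))) (count-white (N v))
      lemma : ∀ d s c → (d ℤ.- s ℤ.+ c ℤ.- d) ℤ.* 1ℤ ℤ.+ s ≡ c
      lemma = ℤSolver.solve-∀
    go white fv≡white = begin
      (+ (b + c) ℤ.- + d) ℤ.* 0ℤ ℤ.+ S               ≡⟨ lemma (+ (b + c) ℤ.- + d) S ⟩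
      S                                              ≡⟨ count-black (N v) ⟨
      + count (λ u → f u ≟ᶜ black) (N v)             ≡⟨ cong +_ (at-white v fv≡white) ⟩
      + c                                            ∎
      where
      lemma : ∀ x s → x ℤ.* 0ℤ ℤ.+ s ≡ s
      lemma = ℤSolver.solve-∀

Σᵥ-map-++ : ∀ {X Y : Set} {j k} (h : Y → ℤ) (g : X → Y) (xs : Vec X j) (ys : Vec Y k) →
            Σᵥ h (map g xs ++ ys) ≡ Σᵥ (h ∘ g) xs ℤ.+ Σᵥ h ys
Σᵥ-map-++ h g []       ys = sym (ℤ.+-identityˡ _)
Σᵥ-map-++ h g (x ∷ xs) ys =
  trans (cong (ℤ._+_ (h (g x))) (Σᵥ-map-++ h g xs ys)) (sym (ℤ.+-assoc (h (g x)) _ _))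

Σᵥ-circulant : ∀ (h : ℤ → ℤ) {k} (ls : Vec ℕ k) v →
               Σᵥ h (circulant ls v) ≡ Σᵥ (λ l → h (v ℤ.+ + l) ℤ.+ h (v ℤ.- + l)) ls
Σᵥ-circulant h ls v = trans (Σᵥ-map-++ h _ ls _) (merge ls)
  where
  merge : ∀ {k} (ls : Vec ℕ k) →
          Σᵥ (λ l → h (v ℤ.+ + l)) ls ℤ.+ Σᵥ h (map (λ l → v ℤ.- + l) ls) ≡
          Σᵥ (λ l → h (v ℤ.+ + l) ℤ.+ h (v ℤ.- + l)) ls
  merge []       = refl
  merge (l ∷ ls) = trans
    (ℤ+.interchange (h (v ℤ.+ + l)) _ (h (v ℤ.- + l)) _)
    (cong (ℤ._+_ (h (v ℤ.+ + l) ℤ.+ h (v ℤ.- + l))) (merge ls))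

theorem2 : (k b c : ℕ) .{{_ : NonZero k}} .{{_ : NonZero b}} .{{_ : NonZero c}} →
    (∃[ ls ] ∃[ f ] IsPerfect2Colouring (circulant {k} ls) f b c) →
    (q : ℕ) (q-prime : Prime q) (t : ℕ) .{{_ : NonZero t}} →
    q ^ t ∣ (b + c) / gcd b c →
    let instance _ = m^n≢0 q t {{prime⇒nonZero q-prime}} in
    b + c ≤ 2 * k + (b + c) / (q ^ t)
theorem2 k b c (ls , f , perfect) q q-prime t q^t∣ =
  finite-valued-solution-bound {{gcd≢0 = gcd-nonZero}} {{q^t≢0 = m^n≢0 q t {{prime⇒nonZero q-prime}}}}
    q-prime q^t∣ ls (enc ∘ f) weight λ v → trans
      (cong (ℤ._+_ ((+ (b + c) ℤ.- + (k + k)) ℤ.* weight (enc (f v))))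
        (sym (Σᵥ-circulant (weight ∘ enc ∘ f) ls v)))
      (perfect-equation f (circulant ls) perfect v)
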